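{- Let $G$ be a connected unicyclic graph (a connected graph containing exactly one cycle). Then $H(G)\ge r(G)$, with equality if and only if $G$ is a cycle on an even number of vertices.
   Context: Graphs are finite, simple and undirected. For a graph $G$ with vertex degrees $d_i=\deg(v_i)$, the Harmonic index is $H(G)=\sum_{v_iv_j\in E(G)} \frac{2}{d_i+d_j}$, the sum being over all edges. The radius $r(G)=\min_{v_i\in V}\max_{v_j\in V}\rho(v_i,v_j)$, where $\rho$ is the shortest-path distance. -}

module Defs where

open import Data.Nat as ℕ using (ℕ; zero; suc; _≤_; _⊓_; _⊔_)
open import Data.Nat.Divisibility using (_∣_)
open import Data.Integer using (+_)
open import Data.Rational as ℚ using (ℚ; 0ℚ)
open import Data.Fin as Fin using (Fin; toℕ; inject₁; fromℕ; _<_)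
open import Data.Fin.Properties using (_≟_)
open import Data.Bool using (Bool; true; false; _∧_; _∨_; if_then_else_)
open import Data.List using (List; []; _∷_; allFin; foldr; map; filter)
open import Data.Product using (Σ; _×_; _,_; ∃)
open import Data.Sum using (_⊎_)
open import Function using (Injective)
open import Function.Bundles using (_↔_; Inverse; _⇔_)
open import Relation.Binary.PropositionalEquality using (_≡_)
open import Relation.Nullary.Decidable using (⌊_⌋)

record Graph (n : ℕ) : Set where
  field
    adj   : Fin n → Fin n → Bool
    sym   : ∀ i j → adj i j ≡ adj j i
    irr   : ∀ i → adj i i ≡ false
open Graph public

Adj : ∀ {n} → Graph n → Fin n → Fin n → Set
Adj G i j = adj G i j ≡ true

countL : ∀ {A : Set} → (A → Bool) → List A → ℕ
countL p = foldr (λ x acc → if p x then suc acc else acc) 0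

deg : ∀ {n} → Graph n → Fin n → ℕ
deg {n} G i = countL (adj G i) (allFin n)

-- 2 / k  (only ever applied with k = d_i + d_j ≥ 2 for an edge v_i v_j)
twoOver : ℕ → ℚ
twoOver zero    = 0ℚ
twoOver (suc k) = (+ 2) ℚ./ suc k

harmonic : ∀ {n} → Graph n → ℚ
harmonic {n} G =
  foldr (λ i acc →
    foldr (λ j acc′ →
      if adj G i j ∧ ⌊ i Fin.<? j ⌋
      then twoOver (deg G i ℕ.+ deg G j) ℚ.+ acc′
      else acc′) acc (allFin n)) 0ℚ (allFin n)

anyF : ∀ {n} → (Fin n → Bool) → Bool
anyF {n} p = foldr (λ x acc → p x ∨ acc) false (allFin n)

reach : ∀ {n} → Graph n → ℕ → Fin n → Fin n → Bool
reach G zero    u v = ⌊ u ≟ v ⌋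
reach G (suc k) u v = reach G k u v ∨ anyF (λ w → reach G k u w ∧ adj G w v)

-- least k ≤ bound with reach G k u v, searched from 0 (returns the
-- bound if none exists; for connected graphs on n vertices the
-- distance is < n so the search with bound n is exact)
distFrom : ∀ {n} → Graph n → ℕ → ℕ → Fin n → Fin n → ℕ
distFrom G k zero      u v = k
distFrom G k (suc fuel) u v =
  if reach G k u v then k else distFrom G (suc k) fuel u v

dist : ∀ {n} → Graph n → Fin n → Fin n → ℕ
dist {n} G u v = distFrom G 0 n u v

ecc : ∀ {n} → Graph n → Fin n → ℕ
ecc {n} G u = foldr (λ v acc → dist G u v ⊔ acc) 0 (allFin n)

-- radius r(G) = min_u ecc(u)  (n ≥ 1 needed for a meaningful value)
radius : ∀ {n} → Graph (suc n) → ℕ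
radius {n} G = foldr (λ u acc → ecc G u ⊓ acc) (ecc G Fin.zero) (allFin (suc n))

data Walk {n} (G : Graph n) : Fin n → Fin n → ℕ → Set where
  here  : ∀ {u} → Walk G u u 0
  step  : ∀ {u w v k} → Adj G u w → Walk G w v k → Walk G u v (suc k)

Connected : ∀ {n} → Graph n → Set
Connected {n} G = ∀ u v → Σ ℕ λ k → Walk G u v k

record Cycle {n} (G : Graph n) : Set where
  field
    m     : ℕ
    vtx   : Fin (suc (suc (suc m))) → Fin n
    inj   : Injective _≡_ _≡_ vtx
    cons  : ∀ (i : Fin (suc (suc m))) → Adj G (vtx (inject₁ i)) (vtx (Fin.suc i))
    close : Adj G (vtx (fromℕ (suc (suc m)))) (vtx Fin.zero)
open Cycle public

CycleEdge : ∀ {n} {G : Graph n} → Cycle G → Fin n → Fin n → Set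
CycleEdge C u v =
  (Σ (Fin (suc (suc (m C)))) λ i →
     (vtx C (inject₁ i) ≡ u × vtx C (Fin.suc i) ≡ v)
   ⊎ (vtx C (inject₁ i) ≡ v × vtx C (Fin.suc i) ≡ u))
  ⊎ ((vtx C (fromℕ (suc (suc (m C)))) ≡ u × vtx C Fin.zero ≡ v)
   ⊎ (vtx C (fromℕ (suc (suc (m C)))) ≡ v × vtx C Fin.zero ≡ u))

-- G contains exactly one cycle (cycles identified with their edge sets,
-- i.e. as subgraphs)
Unicyclic : ∀ {n} → Graph n → Set
Unicyclic G = Cycle G × (∀ (C C′ : Cycle G) u v → CycleEdge C u v ⇔ CycleEdge C′ u v)

CnAdj : ∀ {n} → Fin n → Fin n → Set
CnAdj {n} i j =
  suc (toℕ i) ≡ toℕ j ⊎ suc (toℕ j) ≡ toℕ i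
  ⊎ (suc (toℕ i) ≡ n × toℕ j ≡ 0) ⊎ (suc (toℕ j) ≡ n × toℕ i ≡ 0)

IsCycleGraph : ∀ {n} → Graph n → Set
IsCycleGraph {n} G =
  3 ≤ n × Σ (Fin n ↔ Fin n) λ f →
    ∀ i j → (Adj G (Inverse.to f i) (Inverse.to f j) ⇔ CnAdj i j)

{-# OPTIONS --safe #-}
module Submission where

-- Root the graph at its cycle C: every vertex v off C has a unique neighbour π v closer to C, since a
-- second one would close another cycle.  For a set S that contains C and is closed under π, write s
-- for degrees inside S.  Discharging the vertices outside S towards S, and replacing 2/x by the line
-- through its values at x = 4 and x = 5, gives
--     H(G) ≥ Σ_{v ∈ S} s(v) (9 − 2 s(v)) / 20.
-- The right-hand side is |C|/2 for S = C, and hanging a chain of p new vertices below a vertex of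
-- inner degree s adds p/2 − (s − 1)/5 to it.  Let S consist of C, the chain down to a deepest vertex a, and
-- the chain down to a vertex farthest from a.  The bound then exceeds the eccentricity of a midpoint
-- of these two chains or of the foot of a on C, except when C is even and the two chains are equally
-- long: there either the antipode of a cycle vertex without such a chain is a better centre, or
-- every cycle vertex carries such a chain and S may use four of them.

open import Defs
open import Algebra.Bundles using (CommutativeRing)
import Algebra.Properties.Semiring.Sum as SemiringSum
open import Data.Bool using (Bool; true; false; _∧_; _∨_; not; if_then_else_)
open import Data.Bool.Properties using (∧-zeroʳ; ∧-identityʳ; ∨-zeroʳ)
open import Data.Empty using (⊥; ⊥-elim)
open import Data.Fin as Fin using (Fin; toℕ; inject₁; fromℕ; fromℕ<)
import Data.Fin.Properties as Finₚ
open import Data.Integer as ℤ using (ℤ; +_)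
import Data.Integer.Properties as ℤₚ
import Data.Integer.Tactic.RingSolver as ℤSolver
open import Data.List using (allFin; foldr; tabulate)
open import Data.Nat as ℕ using (ℕ; zero; suc; _+_; _*_; _∸_; _≤_; _<_; z≤n; s≤s; ⌊_/2⌋; ⌈_/2⌉; ∣_-_∣; pred)
open import Data.Nat.Divisibility using (_∣_; divides)
import Data.Nat.Properties as ℕₚ
import Data.Nat.Tactic.RingSolver as ℕSolver
open import Data.Product using (∃; _×_; _,_; proj₁; proj₂)
open import Data.Rational as ℚ using (ℚ; 0ℚ; 1ℚ; _/_)
import Data.Rational.Properties as ℚₚ
open import Data.Rational.Solver using (module +-*-Solver)
open import Data.Rational.Unnormalised as ℚᵘ using (ℚᵘ; mkℚᵘ)
import Data.Rational.Unnormalised.Properties as ℚᵘₚ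
open import Data.Sum using (_⊎_; inj₁; inj₂; [_,_]′)
open import Function using (_∘_; id; case_of_; Injective)
open import Function.Bundles using (_⇔_; mk⇔; mk↔ₛ′; Equivalence; Inverse)
open import Relation.Binary using (tri<; tri≈; tri>)
open import Relation.Binary.Construct.Closure.ReflexiveTransitive using (Star; ε; _◅_; _◅◅_; reverse)
open import Relation.Binary.PropositionalEquality as ≡ using (_≡_; _≢_; refl; trans; cong; cong₂; subst; module ≡-Reasoning)
open import Relation.Nullary using (¬_; Dec; yes; no)
open import Relation.Nullary.Decidable using (⌊_⌋; _×-dec_; _⊎-dec_; map′)

-- The points 4 and 5 are the degree sums that occur most in a cycle with chains hung on it: 4 along
-- the cycle and along the chains, 5 next to a vertex of inner degree 3. The line is exact there.
-- Being affine, it splits into one term per end of an edge, so the edge sum becomes a vertex sum of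
-- integer multiples of 1/20. Cutting off everything outside S costs nothing for two reasons: a
-- child together with all that hangs below it is worth at least a pendant edge, and 2x/(x + 1)
-- increases, so that gifts from outside outweigh the larger denominators inside. The obstacle is
-- the loss of 4/20 for each chain hung on the cycle. Two chains lose 8/20, which is less than the
-- half unit by which rounding, parity or unequal lengths usually put the bound ahead of the radius.
-- For a cycle of 2M vertices with two chains of length h this half unit is missing: the estimate of
-- the radius is M + h, while the bound is M + h - 2/5.

module ℕΣ = SemiringSum ℕₚ.+-*-semiring
module ℤΣ = SemiringSum ℤₚ.+-*-semiring
module ℚΣ = SemiringSum (CommutativeRing.semiring ℚₚ.+-*-commutativeRing)

-- Rational arithmetic

-- The gap y - x equals b - a. A combination of known inequalities thus reduces to one ring
-- identity, which a solver can check.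
lin-≤ : ∀ {a b x y : ℚ} → a ℚ.≤ b → x ℚ.+ b ≡ y ℚ.+ a → x ℚ.≤ y
lin-≤ {a} {b} {x} {y} a≤b eq = begin
  x                    ≡⟨ solve 2 (λ x b → x := x :+ b :+ (:- b)) refl x b ⟩
  x ℚ.+ b ℚ.+ ℚ.- b    ≡⟨ cong (ℚ._+ (ℚ.- b)) eq ⟩
  y ℚ.+ a ℚ.+ ℚ.- b    ≤⟨ ℚₚ.+-monoˡ-≤ (ℚ.- b) (ℚₚ.+-monoʳ-≤ y a≤b) ⟩
  y ℚ.+ b ℚ.+ ℚ.- b    ≡⟨ solve 2 (λ y b → y :+ b :+ (:- b) := y) refl y b ⟩
  y                    ∎
  where open ℚₚ.≤-Reasoning
        open +-*-Solver

toℚᵘ-/ : ∀ i n → ℚ.toℚᵘ (i / suc n) ℚᵘ.≃ mkℚᵘ i n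
toℚᵘ-/ i n = ℚₚ.toℚᵘ-fromℚᵘ (mkℚᵘ i n)

toℚᵘ-/+/ : ∀ i m j n → ℚ.toℚᵘ (i / suc m ℚ.+ j / suc n) ℚᵘ.≃ mkℚᵘ i m ℚᵘ.+ mkℚᵘ j n
toℚᵘ-/+/ i m j n = ℚᵘₚ.≃-trans (ℚₚ.toℚᵘ-homo-+ (i / suc m) (j / suc n))
                               (ℚᵘₚ.+-cong (toℚᵘ-/ i m) (toℚᵘ-/ j n))

-- The normalised quotient `i / n` does not reduce for variable `n`; unnormalised fractions compare
-- by cross-multiplication, which leaves a polynomial inequality.
≤-via-ℚᵘ : ∀ {p q p′ q′} → ℚ.toℚᵘ p ℚᵘ.≃ p′ → ℚ.toℚᵘ q ℚᵘ.≃ q′ → p′ ℚᵘ.≤ q′ → p ℚ.≤ q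
≤-via-ℚᵘ p≃ q≃ p′≤q′ = ℚₚ.toℚᵘ-cancel-≤
  (ℚᵘₚ.≤-trans (ℚᵘₚ.≤-reflexive p≃) (ℚᵘₚ.≤-trans p′≤q′ (ℚᵘₚ.≤-reflexive (ℚᵘₚ.≃-sym q≃))))

≡-via-ℚᵘ : ∀ {p q p′ q′} → ℚ.toℚᵘ p ℚᵘ.≃ p′ → ℚ.toℚᵘ q ℚᵘ.≃ q′ → p′ ℚᵘ.≃ q′ → p ≡ q
≡-via-ℚᵘ p≃ q≃ e = ℚₚ.toℚᵘ-injective (ℚᵘₚ.≃-trans p≃ (ℚᵘₚ.≃-trans e (ℚᵘₚ.≃-sym q≃)))

ι : ℕ → ℚ
ι n = (+ n) / 1

-- Every budget is a multiple of 1/20, so budgets are computed in `ℤ` and enter `ℚ` only through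
-- this map.
twentieths : ℤ → ℚ
twentieths z = z / 20

twentieths-+ : ∀ a b → twentieths (a ℤ.+ b) ≡ twentieths a ℚ.+ twentieths b
twentieths-+ a b = ≡-via-ℚᵘ (toℚᵘ-/ (a ℤ.+ b) 19) (toℚᵘ-/+/ a 19 b 19) (ℚᵘ.*≡* (eq a b))
  where
  eq : ∀ a b → (a ℤ.+ b) ℤ.* + 400 ≡ (a ℤ.* + 20 ℤ.+ b ℤ.* + 20) ℤ.* + 20
  eq = ℤSolver.solve-∀

twentieths-mono-≤ : ∀ {a b} → a ℤ.≤ b → twentieths a ℚ.≤ twentieths b
twentieths-mono-≤ {a} {b} a≤b = ≤-via-ℚᵘ (toℚᵘ-/ a 19) (toℚᵘ-/ b 19)
  (ℚᵘ.*≤* (ℤₚ.*-monoʳ-≤-nonNeg (+ 20) a≤b))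

twentieths-mono-< : ∀ {a b} → a ℤ.< b → twentieths a ℚ.< twentieths b
twentieths-mono-< {a} {b} a<b = ℚₚ.toℚᵘ-cancel-<
  (ℚᵘₚ.<-respˡ-≃ (ℚᵘₚ.≃-sym (toℚᵘ-/ a 19)) (ℚᵘₚ.<-respʳ-≃ (ℚᵘₚ.≃-sym (toℚᵘ-/ b 19))
    (ℚᵘ.*<* (ℤₚ.*-monoʳ-<-pos (+ 20) a<b))))

twentieths-ι : ∀ n → twentieths (+ (20 * n)) ≡ ι n
twentieths-ι n = ≡-via-ℚᵘ (toℚᵘ-/ (+ (20 * n)) 19) (toℚᵘ-/ (+ n) 0)
  (ℚᵘ.*≡* (trans (ℤₚ.*-identityʳ (+ (20 * n))) (trans (ℤₚ.pos-* 20 n) (ℤₚ.*-comm (+ 20) (+ n)))))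

ι-+ : ∀ m n → ι (m + n) ≡ ι m ℚ.+ ι n
ι-+ m n = ≡-via-ℚᵘ (toℚᵘ-/ (+ (m + n)) 0) (toℚᵘ-/+/ (+ m) 0 (+ n) 0)
  (ℚᵘ.*≡* (trans (cong (ℤ._* + 1) (ℤₚ.pos-+ m n)) (eq (+ m) (+ n))))
  where
  eq : ∀ a b → (a ℤ.+ b) ℤ.* + 1 ≡ (a ℤ.* + 1 ℤ.+ b ℤ.* + 1) ℤ.* + 1
  eq = ℤSolver.solve-∀

-- The function 2/x

-- With p = y + 1, both sides have the numerator 2(2p + e + t) over a common denominator. The
-- denominators are (p + e)(p + t) and p(p + e + t), and the first is larger by e t.
twoOver-convex : ∀ y e t → twoOver (suc (y + e)) ℚ.+ twoOver (suc (y + t))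
                         ℚ.≤ twoOver (suc y) ℚ.+ twoOver (suc (y + e + t))
twoOver-convex y e t =
  ≤-via-ℚᵘ (toℚᵘ-/+/ (+ 2) (y + e) (+ 2) (y + t)) (toℚᵘ-/+/ (+ 2) y (+ 2) (y + e + t))
    (ℚᵘ.*≤* (ℤ.+≤+ (subst (lhs ≤_) (eq y e t) (ℕₚ.m≤m+n lhs _))))
  where
  lhs = (2 * suc (y + t) + 2 * suc (y + e)) * (suc y * suc (y + e + t))
  eq : ∀ y e t → (2 * suc (y + t) + 2 * suc (y + e)) * (suc y * suc (y + e + t))
                   + (2 * suc (y + t) + 2 * suc (y + e)) * (e * t)
               ≡ (2 * suc (y + e + t) + 2 * suc y) * (suc (y + e) * suc (y + t))
  eq = ℕSolver.solve-∀

twoOver-anti : ∀ y t → twoOver (suc (y + t)) ℚ.≤ twoOver (suc y)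
twoOver-anti y t = ≤-via-ℚᵘ (toℚᵘ-/ (+ 2) (y + t)) (toℚᵘ-/ (+ 2) y)
  (ℚᵘ.*≤* (ℤ.+≤+ (ℕₚ.*-monoʳ-≤ 2 (s≤s (ℕₚ.m≤m+n y t)))))

ι*twoOver : ∀ s → ι s ℚ.* twoOver (suc s) ℚ.+ twoOver (suc s) ≡ ι 2
ι*twoOver s = ≡-via-ℚᵘ
  (ℚᵘₚ.≃-trans (ℚₚ.toℚᵘ-homo-+ (ι s ℚ.* twoOver (suc s)) (twoOver (suc s)))
    (ℚᵘₚ.+-cong (ℚᵘₚ.≃-trans (ℚₚ.toℚᵘ-homo-* (ι s) (twoOver (suc s)))
                              (ℚᵘₚ.*-cong (toℚᵘ-/ (+ s) 0) (toℚᵘ-/ (+ 2) s)))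
                (toℚᵘ-/ (+ 2) s)))
  (toℚᵘ-/ (+ 2) 0)
  (ℚᵘ.*≡* (eq′ s))
  where
  eq : ∀ x → (x ℤ.* + 2 ℤ.* (+ 1 ℤ.+ x) ℤ.+ + 2 ℤ.* (+ 1 ℤ.* (+ 1 ℤ.+ x))) ℤ.* + 1
           ≡ + 2 ℤ.* ((+ 1 ℤ.* (+ 1 ℤ.+ x)) ℤ.* (+ 1 ℤ.+ x))
  eq = ℤSolver.solve-∀
  eq′ : ∀ s → ((+ s) ℤ.* + 2 ℤ.* + suc s ℤ.+ + 2 ℤ.* + (1 * suc s)) ℤ.* + 1
            ≡ + 2 ℤ.* + ((1 * suc s) * suc s)
  eq′ s rewrite ℤₚ.pos-* (1 * suc s) (suc s) | ℤₚ.pos-* 1 (suc s) = eq (+ s)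

-- By `ι*twoOver` the product is 2 - 2/(s + 1), and 2/x decreases.
ι*twoOver-mono : ∀ s t → ι s ℚ.* twoOver (suc s) ℚ.≤ ι (s + t) ℚ.* twoOver (suc (s + t))
ι*twoOver-mono s t = lin-≤ (twoOver-anti s t) (begin
  ι s ℚ.* twoOver (suc s) ℚ.+ twoOver (suc s)                 ≡⟨ ι*twoOver s ⟩
  ι 2                                                         ≡⟨ ι*twoOver (s + t) ⟨
  ι (s + t) ℚ.* twoOver (suc (s + t)) ℚ.+ twoOver (suc (s + t)) ∎)
  where open ≡-Reasoning

-- Lets a child with t children of its own count as a leaf at a parent of degree d + 1: the gifts of
-- its children make up for the larger denominator. With A, B, C as below, convexity and
-- monotonicity give A + 2B ≤ C + 2, and 2 = (t + 2) B.
twoOver-leaf : ∀ t d → twoOver (suc (suc d)) ℚ.≤ twoOver (suc t + suc d) ℚ.+ ι t ℚ.* twoOver (suc (suc t))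
twoOver-leaf t d = lin-≤
  {a = twoOver (suc (suc d)) ℚ.+ twoOver (suc (suc t)) ℚ.+ twoOver (suc (suc t))}
  {b = twoOver 2 ℚ.+ twoOver (suc (suc (d + t))) ℚ.+ twoOver 2}
  (ℚₚ.+-mono-≤ (twoOver-convex 1 d t) (twoOver-anti 1 t))
  (trans (cong (A ℚ.+_) (cong (λ x → twoOver 2 ℚ.+ x ℚ.+ twoOver 2) Ceq))
     (trans (solve 2 (λ A C → A :+ (con 1ℚ :+ C :+ con 1ℚ) := A :+ C :+ con (ι 2)) refl A C)
       (trans (cong (A ℚ.+ C ℚ.+_) (≡.sym two))
         (solve 4 (λ A C X B → A :+ C :+ ((con 1ℚ :+ X) :* B :+ B) := (C :+ X :* B) :+ (A :+ B :+ B)) refl A C X B))))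
  where
  open +-*-Solver
  A = twoOver (suc (suc d))
  B = twoOver (suc (suc t))
  C = twoOver (suc t + suc d)
  X = ι t
  Ceq : twoOver (suc (suc (d + t))) ≡ C
  Ceq = cong (λ z → twoOver (suc z)) (trans (cong suc (ℕₚ.+-comm d t)) (≡.sym (ℕₚ.+-suc t d)))
  two : (1ℚ ℚ.+ X) ℚ.* B ℚ.+ B ≡ ι 2
  two = trans (cong (λ z → z ℚ.* B ℚ.+ B) (≡.sym (ι-+ 1 t))) (ι*twoOver (suc t))

weight : ℕ → ℤ
weight s = + s ℤ.* (+ 9 ℤ.- + 2 ℤ.* + s)

-- The line is (18 - 2x)/20; at x = s + s′ it is the sum of one `share` for each end.
share : ℕ → ℚ
share s = twentieths (+ 9 ℤ.- + 2 ℤ.* + s)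

ι*share : ∀ s → ι s ℚ.* share s ≡ twentieths (weight s)
ι*share s = ≡-via-ℚᵘ
  (ℚᵘₚ.≃-trans (ℚₚ.toℚᵘ-homo-* (ι s) (share s))
               (ℚᵘₚ.*-cong (toℚᵘ-/ (+ s) 0) (toℚᵘ-/ (+ 9 ℤ.- + 2 ℤ.* + s) 19)))
  (toℚᵘ-/ (weight s) 19) ℚᵘₚ.≃-refl

-- This is (x - 4)(x - 5) ≥ 0, which fails only strictly between 4 and 5 and hence at no integer.
9x≤20+x² : ∀ x → 9 * x ≤ 20 + x * x
9x≤20+x² 0 = z≤n
9x≤20+x² 1 = ℕₚ.m≤m+n 9 12
9x≤20+x² 2 = ℕₚ.m≤m+n 18 6
9x≤20+x² 3 = ℕₚ.m≤m+n 27 2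
9x≤20+x² 4 = ℕₚ.m≤m+n 36 0
9x≤20+x² (suc (suc (suc (suc (suc y))))) = subst (9 * (5 + y) ≤_) (eq y) (ℕₚ.m≤m+n (9 * (5 + y)) _)
  where
  eq : ∀ y → 9 * (5 + y) + (y + y * y) ≡ 20 + (5 + y) * (5 + y)
  eq = ℕSolver.solve-∀

ℤ-lin-≤ : ∀ {a b x y : ℤ} → a ℤ.≤ b → x ℤ.+ b ≡ y ℤ.+ a → x ℤ.≤ y
ℤ-lin-≤ {a} {b} {x} {y} a≤b eq = begin
  x                  ≡⟨ add-sub x b ⟩
  x ℤ.+ b ℤ.- b      ≡⟨ cong (ℤ._- b) eq ⟩
  y ℤ.+ a ℤ.- b      ≤⟨ ℤₚ.+-monoˡ-≤ (ℤ.- b) (ℤₚ.+-monoʳ-≤ y a≤b) ⟩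
  y ℤ.+ b ℤ.- b      ≡⟨ add-sub y b ⟨
  y                  ∎
  where
  open ℤₚ.≤-Reasoning
  add-sub : ∀ x b → x ≡ x ℤ.+ b ℤ.- b
  add-sub = ℤSolver.solve-∀

-- The line through the points x = 4 and x = 5 of 2/x lies below it at every integer.
share-≤ : ∀ s s′ → share (suc s) ℚ.+ share (suc s′) ℚ.≤ twoOver (suc s + suc s′)
share-≤ s s′ = ≤-via-ℚᵘ
  (toℚᵘ-/+/ (+ 9 ℤ.- + 2 ℤ.* + suc s) 19 (+ 9 ℤ.- + 2 ℤ.* + suc s′) 19)
  (toℚᵘ-/ (+ 2) (s + suc s′))
  (ℚᵘ.*≤* (ℤ-lin-≤ {a = + 40 ℤ.* (+ 9 ℤ.* (S ℤ.+ S′))} {b = + 40 ℤ.* (+ 20 ℤ.+ (S ℤ.+ S′) ℤ.* (S ℤ.+ S′))}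
     (ℤₚ.*-monoˡ-≤-nonNeg (+ 40) ineq) (eq S S′)))
  where
  S = + suc s
  S′ = + suc s′
  ineq : + 9 ℤ.* (S ℤ.+ S′) ℤ.≤ + 20 ℤ.+ (S ℤ.+ S′) ℤ.* (S ℤ.+ S′)
  ineq = ℤ.+≤+ (9x≤20+x² (suc s + suc s′))
  eq : ∀ S S′ → ((+ 9 ℤ.- + 2 ℤ.* S) ℤ.* + 20 ℤ.+ (+ 9 ℤ.- + 2 ℤ.* S′) ℤ.* + 20) ℤ.* (S ℤ.+ S′)
                 ℤ.+ + 40 ℤ.* (+ 20 ℤ.+ (S ℤ.+ S′) ℤ.* (S ℤ.+ S′))
              ≡ + 2 ℤ.* + 400 ℤ.+ + 40 ℤ.* (+ 9 ℤ.* (S ℤ.+ S′))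
  eq = ℤSolver.solve-∀

-- What each edge inside the kept set loses because a vertex of inner degree s has t further neighbours.
loss : ℕ → ℕ → ℚ
loss s t = twoOver (suc s) ℚ.- twoOver (suc (s + t))

-- By convexity the drop of 2/x caused by both groups of further neighbours is at most the sum of
-- the separate drops. Since the opposite end has inner degree at least 1, the drop that starts at
-- the full degree sum is at most the one that starts at one more than the own inner degree, which
-- is `loss`. The loss of one end is thus independent of the other end.
edge-bound : ∀ s t s′ t′ →
  (share (suc s) ℚ.- loss (suc s) t) ℚ.+ (share (suc s′) ℚ.- loss (suc s′) t′)
    ℚ.≤ twoOver ((suc s + t) + (suc s′ + t′))
edge-bound s t s′ t′ = lin-≤
  (ℚₚ.+-mono-≤ (ℚₚ.+-mono-≤ (share-≤ s s′) (twoOver-convex x t t′))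
               (ℚₚ.+-mono-≤ c₁ c₂))
  (trans (cong (λ z → p₁ ℚ.+ p₂ ℚ.+ ((twoOver (suc s + suc s′) ℚ.+ (twoOver (suc x) ℚ.+ z)) ℚ.+
               ((twoOver (suc (suc s)) ℚ.+ twoOver (suc (x + t)))
                 ℚ.+ (twoOver (suc (suc s′)) ℚ.+ twoOver (suc (x + t′)))))) teq)
    (solve 10 (λ σ σ′ l l₂ r r₂ q q₁ q₂ z →
      (σ :+ (:- (l :+ (:- l₂)))) :+ (σ′ :+ (:- (r :+ (:- r₂))))
        :+ ((q :+ (q :+ z)) :+ ((l :+ q₁) :+ (r :+ q₂)))
      := z :+ (((σ :+ σ′) :+ (q₁ :+ q₂)) :+ ((q :+ l₂) :+ (q :+ r₂)))) refl
      (share (suc s)) (share (suc s′)) (twoOver (suc (suc s))) (twoOver (suc (suc s + t)))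
      (twoOver (suc (suc s′))) (twoOver (suc (suc s′ + t′)))
      (twoOver (suc x)) (twoOver (suc (x + t))) (twoOver (suc (x + t′)))
      (twoOver ((suc s + t) + (suc s′ + t′)))))
  where
  open +-*-Solver
  x = s + suc s′
  p₁ = share (suc s) ℚ.- loss (suc s) t
  p₂ = share (suc s′) ℚ.- loss (suc s′) t′
  teq : twoOver (suc (x + t + t′)) ≡ twoOver ((suc s + t) + (suc s′ + t′))
  teq = cong twoOver (eq s s′ t t′)
    where
    eq : ∀ s s′ t t′ → suc (s + suc s′ + t + t′) ≡ (suc s + t) + (suc s′ + t′)
    eq = ℕSolver.solve-∀
  c₁ : twoOver (suc x) ℚ.+ twoOver (suc (suc s + t))
         ℚ.≤ twoOver (suc (suc s)) ℚ.+ twoOver (suc (x + t))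
  c₁ rewrite ℕₚ.+-suc s s′ = twoOver-convex (suc s) s′ t
  c₂ : twoOver (suc x) ℚ.+ twoOver (suc (suc s′ + t′))
         ℚ.≤ twoOver (suc (suc s′)) ℚ.+ twoOver (suc (x + t′))
  c₂ rewrite ℕₚ.+-comm s (suc s′) = twoOver-convex (suc s′) s t′

-- Finite sums and counting

when : Bool → ℚ → ℚ
when b x = if b then x else 0ℚ

bit : Bool → ℕ
bit b = if b then 1 else 0

cnt : ∀ {n} → (Fin n → Bool) → ℕ
cnt {n} p = countL p (allFin n)

_≟ᵇ_ : ∀ {n} → Fin n → Fin n → Bool
i ≟ᵇ j = ⌊ i Finₚ.≟ j ⌋

isYes-true : ∀ {P : Set} (d : Dec P) → P → ⌊ d ⌋ ≡ true
isYes-true (yes _) _ = refl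
isYes-true (no ¬p) p = ⊥-elim (¬p p)

isYes-false : ∀ {P : Set} (d : Dec P) → ¬ P → ⌊ d ⌋ ≡ false
isYes-false (yes p) ¬p = ⊥-elim (¬p p)
isYes-false (no _)  _  = refl

if-true : ∀ {A : Set} {b} {x y : A} → b ≡ true → (if b then x else y) ≡ x
if-true refl = refl

if-false : ∀ {A : Set} {b} {x y : A} → b ≡ false → (if b then x else y) ≡ y
if-false refl = refl

≟ᵇ-refl : ∀ {n} (i : Fin n) → (i ≟ᵇ i) ≡ true
≟ᵇ-refl i = isYes-true (i Finₚ.≟ i) refl

≟ᵇ-≢ : ∀ {n} {i j : Fin n} → i ≢ j → (i ≟ᵇ j) ≡ false
≟ᵇ-≢ {i = i} {j} i≢j = isYes-false (i Finₚ.≟ j) i≢j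

true≢false : ∀ {b} → b ≡ true → b ≡ false → ⊥
true≢false refl ()

cnt-sum : ∀ {n} (p : Fin n → Bool) → cnt p ≡ ℕΣ.sum (bit ∘ p)
cnt-sum {n} p = go n id
  where
  go : ∀ m (g : Fin m → Fin n) → countL p (tabulate g) ≡ ℕΣ.sum (bit ∘ p ∘ g)
  go zero    g = refl
  go (suc m) g with p (g Fin.zero)
  ... | true  = cong suc (go m (g ∘ Fin.suc))
  ... | false = go m (g ∘ Fin.suc)

cnt-cong : ∀ {n} {p q : Fin n → Bool} → (∀ j → p j ≡ q j) → cnt p ≡ cnt q
cnt-cong {p = p} {q} p≗q = trans (cnt-sum p) (trans (ℕΣ.sum-cong-≗ (cong bit ∘ p≗q)) (≡.sym (cnt-sum q)))

cnt-none : ∀ {n} {p : Fin n → Bool} → (∀ j → p j ≡ false) → cnt p ≡ 0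
cnt-none {n} {p} none = trans (cnt-sum p)
  (trans (ℕΣ.sum-cong-≗ {y = λ _ → 0} (cong bit ∘ none)) (ℕΣ.sum-replicate-zero n))

_∖_ : ∀ {n} → (Fin n → Bool) → Fin n → Fin n → Bool
(p ∖ x) j = p j ∧ not (j ≟ᵇ x)

ℕ-sum-update : ∀ {n} (f g : Fin n → ℕ) x → (∀ j → j ≢ x → f j ≡ g j) →
  ℕΣ.sum f + g x ≡ ℕΣ.sum g + f x
ℕ-sum-update {suc n} f g x f≗g = begin
  ℕΣ.sum f + g x                        ≡⟨ cong (_+ g x) (ℕΣ.sum-remove {i = x} f) ⟩
  f x + rest f + g x                    ≡⟨ cong (λ z → f x + z + g x) (ℕΣ.sum-cong-≗ λ j → f≗g _ (Finₚ.punchInᵢ≢i x j)) ⟩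
  f x + rest g + g x                    ≡⟨ swap (f x) (rest g) (g x) ⟩
  g x + rest g + f x                    ≡⟨ cong (_+ f x) (ℕΣ.sum-remove {i = x} g) ⟨
  ℕΣ.sum g + f x                        ∎
  where
  open ≡-Reasoning
  rest : (Fin (suc n) → ℕ) → ℕ
  rest h = ℕΣ.sum (h ∘ Fin.punchIn x)
  swap : ∀ a b c → a + b + c ≡ c + b + a
  swap = ℕSolver.solve-∀

ℤ-sum-update : ∀ {n} (f g : Fin n → ℤ) x → (∀ j → j ≢ x → f j ≡ g j) →
  ℤΣ.sum f ℤ.+ g x ≡ ℤΣ.sum g ℤ.+ f x
ℤ-sum-update {suc n} f g x f≗g = begin
  ℤΣ.sum f ℤ.+ g x                      ≡⟨ cong (ℤ._+ g x) (ℤΣ.sum-remove {i = x} f) ⟩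
  f x ℤ.+ rest f ℤ.+ g x                ≡⟨ cong (λ z → f x ℤ.+ z ℤ.+ g x) (ℤΣ.sum-cong-≗ λ j → f≗g _ (Finₚ.punchInᵢ≢i x j)) ⟩
  f x ℤ.+ rest g ℤ.+ g x                ≡⟨ swap (f x) (rest g) (g x) ⟩
  g x ℤ.+ rest g ℤ.+ f x                ≡⟨ cong (ℤ._+ f x) (ℤΣ.sum-remove {i = x} g) ⟨
  ℤΣ.sum g ℤ.+ f x                      ∎
  where
  open ≡-Reasoning
  rest : (Fin (suc n) → ℤ) → ℤ
  rest h = ℤΣ.sum (h ∘ Fin.punchIn x)
  swap : ∀ a b c → a ℤ.+ b ℤ.+ c ≡ c ℤ.+ b ℤ.+ a
  swap = ℤSolver.solve-∀

cnt-remove : ∀ {n} (p : Fin n → Bool) x → p x ≡ true → cnt p ≡ suc (cnt (p ∖ x))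
cnt-remove p x px = begin
  cnt p                              ≡⟨ cnt-sum p ⟩
  ℕΣ.sum (bit ∘ p)                   ≡⟨ ℕₚ.+-identityʳ _ ⟨
  ℕΣ.sum (bit ∘ p) + 0               ≡⟨ cong (λ b → ℕΣ.sum (bit ∘ p) + bit b) (trans (cong (λ b → p x ∧ not b) (≟ᵇ-refl x)) (∧-zeroʳ (p x))) ⟨
  ℕΣ.sum (bit ∘ p) + bit ((p ∖ x) x) ≡⟨ ℕ-sum-update (bit ∘ p) (bit ∘ (p ∖ x)) x (λ j j≢x → cong bit (≡.sym (trans (cong (λ b → p j ∧ not b) (≟ᵇ-≢ j≢x)) (∧-identityʳ (p j))))) ⟩
  ℕΣ.sum (bit ∘ (p ∖ x)) + bit (p x) ≡⟨ cong₂ _+_ (≡.sym (cnt-sum (p ∖ x))) (cong bit px) ⟩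
  cnt (p ∖ x) + 1                    ≡⟨ ℕₚ.+-comm _ 1 ⟩
  suc (cnt (p ∖ x))                  ∎
  where open ≡-Reasoning

∖-true : ∀ {n} (p : Fin n → Bool) {x j} → (p ∖ x) j ≡ true → p j ≡ true × j ≢ x
∖-true p {x} {j} e with p j | j Finₚ.≟ x
∖-true p () | true | yes _
... | true | no j≢x = refl , j≢x

∖-≢ : ∀ {n} (p : Fin n → Bool) {x j} → p j ≡ true → j ≢ x → (p ∖ x) j ≡ true
∖-≢ p {x} {j} pj j≢x rewrite pj | ≟ᵇ-≢ j≢x = refl

all-false : ∀ {n} {p : Fin n → Bool} → (∀ j → p j ≡ true → ⊥) → ∀ j → p j ≡ false
all-false {p = p} no-j j with p j in eq
... | true  = ⊥-elim (no-j j eq)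
... | false = refl

cnt-one : ∀ {n} (p : Fin n → Bool) x → p x ≡ true → (∀ j → p j ≡ true → j ≡ x) → cnt p ≡ 1
cnt-one p x px only = trans (cnt-remove p x px)
  (cong suc (cnt-none (all-false λ j e → let (pj , j≢x) = ∖-true p e in j≢x (only j pj))))

cnt-two : ∀ {n} (p : Fin n → Bool) x y → x ≢ y → p x ≡ true → p y ≡ true →
  (∀ j → p j ≡ true → j ≡ x ⊎ j ≡ y) → cnt p ≡ 2
cnt-two p x y x≢y px py only = trans (cnt-remove p x px)
  (cong suc (cnt-one (p ∖ x) y (∖-≢ p py (x≢y ∘ ≡.sym)) λ j e → let (pj , j≢x) = ∖-true p e in
    [ (λ j≡x → ⊥-elim (j≢x j≡x)) , id ]′ (only j pj)))

cnt-split : ∀ {n} (p q : Fin n → Bool) → cnt p ≡ cnt (λ j → p j ∧ q j) + cnt (λ j → p j ∧ not (q j))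
cnt-split p q = begin
  cnt p                                       ≡⟨ cnt-sum p ⟩
  ℕΣ.sum (bit ∘ p)                            ≡⟨ ℕΣ.sum-cong-≗ (λ j → bits (p j) (q j)) ⟩
  ℕΣ.sum (λ j → bit (p j ∧ q j) + bit (p j ∧ not (q j)))
    ≡⟨ ℕΣ.∑-distrib-+ (λ j → bit (p j ∧ q j)) (λ j → bit (p j ∧ not (q j))) ⟩
  ℕΣ.sum (λ j → bit (p j ∧ q j)) + ℕΣ.sum (λ j → bit (p j ∧ not (q j)))
    ≡⟨ cong₂ _+_ (cnt-sum (λ j → p j ∧ q j)) (cnt-sum (λ j → p j ∧ not (q j))) ⟨
  cnt (λ j → p j ∧ q j) + cnt (λ j → p j ∧ not (q j)) ∎
  where
  open ≡-Reasoning
  bits : ∀ a b → bit a ≡ bit (a ∧ b) + bit (a ∧ not b)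
  bits false _     = refl
  bits true  false = refl
  bits true  true  = refl

ℚ-sum-mono : ∀ {n} {f g : Fin n → ℚ} → (∀ i → f i ℚ.≤ g i) → ℚΣ.sum f ℚ.≤ ℚΣ.sum g
ℚ-sum-mono {zero}  f≤g = ℚₚ.≤-refl
ℚ-sum-mono {suc n} f≤g = ℚₚ.+-mono-≤ (f≤g Fin.zero) (ℚ-sum-mono (f≤g ∘ Fin.suc))

twentieths-sum : ∀ {n} (f : Fin n → ℤ) → twentieths (ℤΣ.sum f) ≡ ℚΣ.sum (twentieths ∘ f)
twentieths-sum {zero}  f = refl
twentieths-sum {suc n} f = trans (twentieths-+ (f Fin.zero) _)
  (cong (twentieths (f Fin.zero) ℚ.+_) (twentieths-sum (f ∘ Fin.suc)))

sum-when : ∀ {n} (p : Fin n → Bool) x → ℚΣ.sum (λ j → when (p j) x) ≡ ι (cnt p) ℚ.* x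
sum-when {n} p x = trans (go p) (cong (λ z → ι z ℚ.* x) (≡.sym (cnt-sum p)))
  where
  go : ∀ {m} (p : Fin m → Bool) → ℚΣ.sum (λ j → when (p j) x) ≡ ι (ℕΣ.sum (bit ∘ p)) ℚ.* x
  go {zero}  p = ≡.sym (ℚₚ.*-zeroˡ x)
  go {suc m} p with p Fin.zero
  ... | false = trans (ℚₚ.+-identityˡ _) (go (p ∘ Fin.suc))
  ... | true  = begin
    x ℚ.+ ℚΣ.sum (λ j → when (p (Fin.suc j)) x) ≡⟨ cong (x ℚ.+_) (go (p ∘ Fin.suc)) ⟩
    x ℚ.+ ι k ℚ.* x                             ≡⟨ solve 2 (λ x k → x :+ k :* x := (con 1ℚ :+ k) :* x) refl x (ι k) ⟩
    (1ℚ ℚ.+ ι k) ℚ.* x                          ≡⟨ cong (ℚ._* x) (ι-+ 1 k) ⟨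
    ι (suc k) ℚ.* x                             ∎
    where
    open ≡-Reasoning
    open +-*-Solver
    k = ℕΣ.sum (bit ∘ p ∘ Fin.suc)

sum-when-if : ∀ {n} (p q : Fin n → Bool) x y →
  ℚΣ.sum (λ j → when (p j) (if q j then x else y))
    ≡ ι (cnt (λ j → p j ∧ q j)) ℚ.* x ℚ.+ ι (cnt (λ j → p j ∧ not (q j))) ℚ.* y
sum-when-if p q x y = begin
  ℚΣ.sum (λ j → when (p j) (if q j then x else y))
    ≡⟨ ℚΣ.sum-cong-≗ (λ j → split (p j) (q j)) ⟩
  ℚΣ.sum (λ j → when (p j ∧ q j) x ℚ.+ when (p j ∧ not (q j)) y)
    ≡⟨ ℚΣ.∑-distrib-+ (λ j → when (p j ∧ q j) x) (λ j → when (p j ∧ not (q j)) y) ⟩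
  ℚΣ.sum (λ j → when (p j ∧ q j) x) ℚ.+ ℚΣ.sum (λ j → when (p j ∧ not (q j)) y)
    ≡⟨ cong₂ ℚ._+_ (sum-when (λ j → p j ∧ q j) x) (sum-when (λ j → p j ∧ not (q j)) y) ⟩
  _ ∎
  where
  open ≡-Reasoning
  split : ∀ a b → when a (if b then x else y) ≡ when (a ∧ b) x ℚ.+ when (a ∧ not b) y
  split false _     = refl
  split true  true  = ≡.sym (ℚₚ.+-identityʳ x)
  split true  false = ≡.sym (ℚₚ.+-identityˡ y)

-- The harmonic index as a sum over ordered pairs

-- `harmonic` starts its inner fold at the accumulator of the outer one, hence the arbitrary end
-- value `e`.
foldr-if : ∀ {m n} (p : Fin m → Bool) (f : Fin m → ℚ) (e : ℚ) (g : Fin n → Fin m) →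
  foldr (λ j acc → if p j then f j ℚ.+ acc else acc) e (tabulate g)
    ≡ ℚΣ.sum (λ j → when (p (g j)) (f (g j))) ℚ.+ e
foldr-if {n = zero}  p f e g = ≡.sym (ℚₚ.+-identityˡ e)
foldr-if {n = suc n} p f e g with p (g Fin.zero)
... | true  = trans (cong (f (g Fin.zero) ℚ.+_) (foldr-if p f e (g ∘ Fin.suc)))
                    (≡.sym (ℚₚ.+-assoc (f (g Fin.zero)) _ e))
... | false = trans (foldr-if p f e (g ∘ Fin.suc)) (cong (ℚ._+ e) (≡.sym (ℚₚ.+-identityˡ (ℚΣ.sum (λ j → when (p (g (Fin.suc j))) (f (g (Fin.suc j))))))))

foldr-+ : ∀ {m n} (op : Fin m → ℚ → ℚ) (r : Fin m → ℚ) → (∀ i acc → op i acc ≡ r i ℚ.+ acc) →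
  (g : Fin n → Fin m) → foldr op 0ℚ (tabulate g) ≡ ℚΣ.sum (r ∘ g)
foldr-+ {n = zero}  op r h g = refl
foldr-+ {n = suc n} op r h g = trans (h (g Fin.zero) _)
  (cong (r (g Fin.zero) ℚ.+_) (foldr-+ op r h (g ∘ Fin.suc)))

_<ᵇ_ : ∀ {n} → Fin n → Fin n → Bool
i <ᵇ j = ⌊ i Fin.<? j ⌋

inner-bound : ∀ {s t s′ t′ d d′} → d ≡ s + t → d′ ≡ s′ + t′ → 0 < s → 0 < s′ →
  (share s ℚ.- loss s t) ℚ.+ (share s′ ℚ.- loss s′ t′) ℚ.≤ twoOver (d + d′)
inner-bound {suc s} {t} {suc s′} {t′} refl refl _ _ = edge-bound s t s′ t′

leaf-bound : ∀ {d d′} → 0 < d → 0 < d′ →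
  ℚ.- (ι (pred d) ℚ.* twoOver (suc d)) ℚ.+ twoOver (suc d′) ℚ.≤ twoOver (d + d′)
leaf-bound {suc t} {suc d} _ _ = lin-≤ (twoOver-leaf t d)
  (solve 3 (λ x g z → :- x :+ g :+ (z :+ x) := z :+ g) refl
    (ι t ℚ.* twoOver (suc (suc t))) (twoOver (suc (suc d))) (twoOver (suc t + suc d)))
  where open +-*-Solver

-- With U = 2/(s + 1) and T = 2/(s + t + 1), the losses on the inner edges are s(U - T) and the
-- gifts are t T. It remains that s U ≤ (s + t) T, the monotonicity of 2x/(x + 1).
repay : ∀ {s t d} → d ≡ s + t →
  twentieths (weight s) ℚ.≤ ι s ℚ.* (share s ℚ.- loss s t) ℚ.+ ι t ℚ.* twoOver (suc d)
repay {s} {t} refl = lin-≤ (ι*twoOver-mono s t)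
  (trans (cong₂ (λ w z → w ℚ.+ z ℚ.* T) (≡.sym (ι*share s)) (ι-+ s t))
    (solve 5 (λ s t σ T U → s :* σ :+ (s :+ t) :* T := s :* (σ :+ (:- (U :+ (:- T)))) :+ t :* T :+ s :* U)
      refl (ι s) (ι t) (share s) T (twoOver (suc s))))
  where
  open +-*-Solver
  T = twoOver (suc (s + t))

module _ {n : ℕ} (G : Graph n) where

  edgeSum : (Fin n → Fin n → ℚ) → ℚ
  edgeSum e = ℚΣ.sum (λ i → ℚΣ.sum (λ j → when (adj G i j ∧ (i <ᵇ j)) (e i j)))

  arcSum : (Fin n → Fin n → ℚ) → ℚ
  arcSum F = ℚΣ.sum (λ i → ℚΣ.sum (λ j → when (adj G i j) (F i j)))

  harmonic-edgeSum : harmonic G ≡ edgeSum (λ i j → twoOver (deg G i + deg G j))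
  harmonic-edgeSum = foldr-+ _ _ (λ i acc →
    foldr-if (λ j → adj G i j ∧ (i <ᵇ j)) (λ j → twoOver (deg G i + deg G j)) acc id) id

  -- Exchanging the order of summation turns the terms `F j i` with i < j into the terms with i > j.
  -- A discharging rule may therefore be given on ordered pairs and evaluated row by row.
  edgeSum-symmetrise : ∀ F → edgeSum (λ i j → F i j ℚ.+ F j i) ≡ arcSum F
  edgeSum-symmetrise F = begin
    edgeSum (λ i j → F i j ℚ.+ F j i)
      ≡⟨ ℚΣ.sum-cong-≗ (λ i → trans (ℚΣ.sum-cong-≗ (λ j → when-+ (up i j) (F i j) (F j i)))
           (ℚΣ.∑-distrib-+ (λ j → when (up i j) (F i j)) (λ j → when (up i j) (F j i)))) ⟩
    ℚΣ.sum (λ i → ℚΣ.sum (λ j → when (up i j) (F i j)) ℚ.+ ℚΣ.sum (λ j → when (up i j) (F j i)))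
      ≡⟨ ℚΣ.∑-distrib-+ (λ i → ℚΣ.sum (λ j → when (up i j) (F i j))) (λ i → ℚΣ.sum (λ j → when (up i j) (F j i))) ⟩
    edgeSum F ℚ.+ ℚΣ.sum (λ i → ℚΣ.sum (λ j → when (up i j) (F j i)))
      ≡⟨ cong (edgeSum F ℚ.+_) (ℚΣ.∑-comm (λ i j → when (up i j) (F j i))) ⟩
    edgeSum F ℚ.+ ℚΣ.sum (λ i → ℚΣ.sum (λ j → when (up j i) (F i j)))
      ≡⟨ ℚΣ.∑-distrib-+ (λ i → ℚΣ.sum (λ j → when (up i j) (F i j))) (λ i → ℚΣ.sum (λ j → when (up j i) (F i j))) ⟨
    ℚΣ.sum (λ i → ℚΣ.sum (λ j → when (up i j) (F i j)) ℚ.+ ℚΣ.sum (λ j → when (up j i) (F i j)))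
      ≡⟨ ℚΣ.sum-cong-≗ (λ i → trans
           (≡.sym (ℚΣ.∑-distrib-+ (λ j → when (up i j) (F i j)) (λ j → when (up j i) (F i j))))
           (ℚΣ.sum-cong-≗ (λ j → merge i j (F i j)))) ⟩
    arcSum F ∎
    where
    open ≡-Reasoning
    up : Fin n → Fin n → Bool
    up i j = adj G i j ∧ (i <ᵇ j)
    when-+ : ∀ b x y → when b (x ℚ.+ y) ≡ when b x ℚ.+ when b y
    when-+ true  x y = refl
    when-+ false x y = refl
    merge : ∀ i j x → when (up i j) x ℚ.+ when (up j i) x ≡ when (adj G i j) x
    merge i j x with Finₚ.<-cmp i j
    ... | tri< i<j _ j≮i rewrite isYes-true (i Fin.<? j) i<j | isYes-false (j Fin.<? i) j≮i
                               | ∧-zeroʳ (adj G j i) | ∧-identityʳ (adj G i j) = ℚₚ.+-identityʳ _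
    ... | tri> i≮j _ j<i rewrite isYes-false (i Fin.<? j) i≮j | isYes-true (j Fin.<? i) j<i
                               | ∧-zeroʳ (adj G i j) | ∧-identityʳ (adj G j i) | Graph.sym G j i = ℚₚ.+-identityˡ _
    ... | tri≈ _ refl _ rewrite irr G i = refl

  edgeSum-mono : ∀ {e e′} → (∀ i j → Adj G i j → e i j ℚ.≤ e′ i j) → edgeSum e ℚ.≤ edgeSum e′
  edgeSum-mono {e} {e′} e≤e′ = ℚ-sum-mono λ i → ℚ-sum-mono λ j → go i j
    where
    go : ∀ i j → when (adj G i j ∧ (i <ᵇ j)) (e i j) ℚ.≤ when (adj G i j ∧ (i <ᵇ j)) (e′ i j)
    go i j with adj G i j in eq | i <ᵇ j
    ... | false | _     = ℚₚ.≤-refl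
    ... | true  | false = ℚₚ.≤-refl
    ... | true  | true  = e≤e′ i j eq

  arcSum≤harmonic : ∀ F → (∀ i j → Adj G i j → F i j ℚ.+ F j i ℚ.≤ twoOver (deg G i + deg G j)) →
    arcSum F ℚ.≤ harmonic G
  arcSum≤harmonic F h = begin
    arcSum F                                         ≡⟨ edgeSum-symmetrise F ⟨
    edgeSum (λ i j → F i j ℚ.+ F j i)                ≤⟨ edgeSum-mono h ⟩
    edgeSum (λ i j → twoOver (deg G i + deg G j))    ≡⟨ harmonic-edgeSum ⟨
    harmonic G                                       ∎
    where open ℚₚ.≤-Reasoning

  harmonic≤arcSum : ∀ F → (∀ i j → Adj G i j → twoOver (deg G i + deg G j) ℚ.≤ F i j ℚ.+ F j i) →
    harmonic G ℚ.≤ arcSum F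
  harmonic≤arcSum F h = begin
    harmonic G                                       ≡⟨ harmonic-edgeSum ⟩
    edgeSum (λ i j → twoOver (deg G i + deg G j))    ≤⟨ edgeSum-mono h ⟩
    edgeSum (λ i j → F i j ℚ.+ F j i)                ≡⟨ edgeSum-symmetrise F ⟩
    arcSum F                                         ∎
    where open ℚₚ.≤-Reasoning

  inner : (Fin n → Bool) → Fin n → ℕ
  inner σ i = cnt (λ j → adj G i j ∧ σ j)

  budget : (Fin n → Bool) → ℤ
  budget σ = ℤΣ.sum (λ i → if σ i then weight (inner σ i) else ℤ.0ℤ)

  -- Discharging: F splits every 2/(d i + d j) between its two ends.  A vertex outside the kept set σ
  -- passes everything its children give it on to its parent, and a vertex of σ uses what it
  -- receives from outside to make up for the loss on its edges inside σ.
  module Discharge (σ : Fin n → Bool) (par : Fin n → Fin n)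
    (par-adj : ∀ i → σ i ≡ false → Adj G i (par i))
    (par-asym : ∀ i j → σ i ≡ false → σ j ≡ false → j ≡ par i → i ≡ par j → ⊥)
    (edge-cases : ∀ i j → Adj G i j → (σ i ≡ true × σ j ≡ true)
       ⊎ (σ i ≡ false × j ≡ par i) ⊎ (σ j ≡ false × i ≡ par j)) where

    outer : Fin n → ℕ
    outer i = cnt (λ j → adj G i j ∧ not (σ j))

    deg-split : ∀ i → deg G i ≡ inner σ i + outer i
    deg-split i = cnt-split (adj G i) σ

    -- What `i` gets from each child: the value of a pendant edge at `i`, whatever hangs below that
    -- child.
    gift : Fin n → ℚ
    gift i = twoOver (suc (deg G i))

    keep : Fin n → ℚ
    keep i = share (inner σ i) ℚ.- loss (inner σ i) (outer i)

    -- An outside vertex has one parent and `pred (deg G i)` children. The total of their gifts is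
    -- charged to the edge to the parent, which makes the row of `i` sum to 0.
    due : Fin n → ℚ
    due i = ι (pred (deg G i)) ℚ.* gift i

    F : Fin n → Fin n → ℚ
    F i j = if σ i then (if σ j then keep i else gift i) else (if j ≟ᵇ par i then ℚ.- due i else gift i)

    up-bound : ∀ i j → Adj G i j → ℚ.- due i ℚ.+ gift j ℚ.≤ twoOver (deg G i + deg G j)
    up-bound i j e = leaf-bound (deg-pos i j e) (deg-pos j i (trans (Graph.sym G j i) e))
      where
      deg-pos : ∀ i j → Adj G i j → 0 < deg G i
      deg-pos i j e = subst (0 <_) (≡.sym (cnt-remove (adj G i) j e)) (s≤s z≤n)

    inside : ∀ i j → Adj G i j → σ i ≡ true → σ j ≡ true → keep i ℚ.+ keep j ℚ.≤ twoOver (deg G i + deg G j)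
    inside i j e σi σj = inner-bound (deg-split i) (deg-split j)
      (inner-pos i j e σj) (inner-pos j i (trans (Graph.sym G j i) e) σi)
      where
      inner-pos : ∀ i j → Adj G i j → σ j ≡ true → 0 < inner σ i
      inner-pos i j e σj = subst (0 <_) (≡.sym (cnt-remove (λ j → adj G i j ∧ σ j) j (cong₂ _∧_ e σj))) (s≤s z≤n)

    F-inside : ∀ i j → σ i ≡ true → σ j ≡ true → F i j ≡ keep i
    F-inside i j σi σj = trans (if-true σi) (if-true σj)

    F-up : ∀ i j → σ i ≡ false → j ≡ par i → F i j ≡ ℚ.- due i
    F-up i j σi refl = trans (if-false σi) (if-true (≟ᵇ-refl (par i)))

    F-down : ∀ i j → σ j ≡ false → i ≡ par j → F i j ≡ gift i
    F-down i j σj i≡ = go (σ i) refl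
      where
      go : ∀ b → σ i ≡ b → F i j ≡ gift i
      go true  σi = trans (if-true σi) (if-false σj)
      -- With both ends outside, the arc from parent to child must fail the parent test; `par-asym`
      -- ensures it.
      go false σi = trans (if-false σi)
        (if-false (≟ᵇ-≢ (λ j≡ → par-asym i j σi σj j≡ i≡)))

    F-edge : ∀ i j → Adj G i j → F i j ℚ.+ F j i ℚ.≤ twoOver (deg G i + deg G j)
    F-edge i j e = go (edge-cases i j e)
      where
      open ℚₚ.≤-Reasoning
      go : _ → F i j ℚ.+ F j i ℚ.≤ twoOver (deg G i + deg G j)
      go (inj₁ (σi , σj)) = begin
        F i j ℚ.+ F j i               ≡⟨ cong₂ ℚ._+_ (F-inside i j σi σj) (F-inside j i σj σi) ⟩
        keep i ℚ.+ keep j             ≤⟨ inside i j e σi σj ⟩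
        twoOver (deg G i + deg G j)   ∎
      go (inj₂ (inj₁ (σi , j≡))) = begin
        F i j ℚ.+ F j i               ≡⟨ cong₂ ℚ._+_ (F-up i j σi j≡) (F-down j i σi j≡) ⟩
        ℚ.- due i ℚ.+ gift j          ≤⟨ up-bound i j e ⟩
        twoOver (deg G i + deg G j)   ∎
      go (inj₂ (inj₂ (σj , i≡))) = begin
        F i j ℚ.+ F j i               ≡⟨ cong₂ ℚ._+_ (F-down i j σj i≡) (F-up j i σj i≡) ⟩
        gift i ℚ.- due j              ≡⟨ ℚₚ.+-comm (gift i) (ℚ.- due j) ⟩
        ℚ.- due j ℚ.+ gift i          ≤⟨ up-bound j i (trans (Graph.sym G j i) e) ⟩
        twoOver (deg G j + deg G i)   ≡⟨ cong twoOver (ℕₚ.+-comm (deg G j) (deg G i)) ⟩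
        twoOver (deg G i + deg G j)   ∎

    only-par : ∀ i j → adj G i j ∧ (j ≟ᵇ par i) ≡ true → j ≡ par i
    only-par i j e with adj G i j | j Finₚ.≟ par i
    ... | true | yes j≡ = j≡
    only-par i j () | true | no _

    row-inside : ∀ i → σ i ≡ true → twentieths (weight (inner σ i)) ℚ.≤ ℚΣ.sum (λ j → when (adj G i j) (F i j))
    row-inside i σi = begin
      twentieths (weight (inner σ i))
        ≤⟨ repay {inner σ i} {outer i} (deg-split i) ⟩
      ι (inner σ i) ℚ.* keep i ℚ.+ ι (outer i) ℚ.* gift i
        ≡⟨ sum-when-if (adj G i) σ (keep i) (gift i) ⟨
      ℚΣ.sum (λ j → when (adj G i j) (if σ j then keep i else gift i))
        ≡⟨ ℚΣ.sum-cong-≗ (λ j → cong (when (adj G i j)) (≡.sym (if-true σi))) ⟩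
      ℚΣ.sum (λ j → when (adj G i j) (F i j)) ∎
      where open ℚₚ.≤-Reasoning

    row-outside : ∀ i → σ i ≡ false → 0ℚ ≡ ℚΣ.sum (λ j → when (adj G i j) (F i j))
    row-outside i σi = begin
      0ℚ
        ≡⟨ solve 1 (λ x → con 0ℚ := con 1ℚ :* (:- x) :+ x) refl (due i) ⟩
      ι 1 ℚ.* (ℚ.- due i) ℚ.+ ι (pred (deg G i)) ℚ.* gift i
        ≡⟨ cong₂ (λ c d → ι c ℚ.* (ℚ.- due i) ℚ.+ ι (pred d) ℚ.* gift i)
             (≡.sym (cnt-one (λ j → adj G i j ∧ (j ≟ᵇ par i)) (par i)
               (cong₂ _∧_ (par-adj i σi) (≟ᵇ-refl (par i))) (only-par i)))
             (cnt-remove (adj G i) (par i) (par-adj i σi)) ⟩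
      ι (cnt (λ j → adj G i j ∧ (j ≟ᵇ par i))) ℚ.* (ℚ.- due i) ℚ.+ ι (cnt (adj G i ∖ par i)) ℚ.* gift i
        ≡⟨ sum-when-if (adj G i) (_≟ᵇ par i) (ℚ.- due i) (gift i) ⟨
      ℚΣ.sum (λ j → when (adj G i j) (if j ≟ᵇ par i then ℚ.- due i else gift i))
        ≡⟨ ℚΣ.sum-cong-≗ (λ j → cong (when (adj G i j)) (≡.sym (if-false σi))) ⟩
      ℚΣ.sum (λ j → when (adj G i j) (F i j)) ∎
      where
      open ≡-Reasoning
      open +-*-Solver

    row : ∀ i → twentieths (if σ i then weight (inner σ i) else ℤ.0ℤ) ℚ.≤ ℚΣ.sum (λ j → when (adj G i j) (F i j))
    row i = go (σ i) refl
      where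
      go : ∀ b → σ i ≡ b →
        twentieths (if σ i then weight (inner σ i) else ℤ.0ℤ) ℚ.≤ ℚΣ.sum (λ j → when (adj G i j) (F i j))
      go true  σi = ℚₚ.≤-trans (ℚₚ.≤-reflexive (cong twentieths (if-true σi))) (row-inside i σi)
      go false σi = ℚₚ.≤-reflexive (trans (cong twentieths (if-false σi)) (row-outside i σi))

    budget≤harmonic : twentieths (budget σ) ℚ.≤ harmonic G
    budget≤harmonic = begin
      twentieths (budget σ)  ≡⟨ twentieths-sum (λ i → if σ i then weight (inner σ i) else ℤ.0ℤ) ⟩
      _                      ≤⟨ ℚ-sum-mono row ⟩
      arcSum F               ≤⟨ arcSum≤harmonic F F-edge ⟩
      harmonic G             ∎
      where open ℚₚ.≤-Reasoning

-- Distances, eccentricities and the radius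

module _ {n : ℕ} {G : Graph n} where

  adj-sym : ∀ {u v} → Adj G u v → Adj G v u
  adj-sym {u} {v} e = trans (Graph.sym G v u) e

  walk-++ : ∀ {u v w k l} → Walk G u v k → Walk G v w l → Walk G u w (k + l)
  walk-++ here       q = q
  walk-++ (step e p) q = step e (walk-++ p q)

  walk-reverse : ∀ {u v k} → Walk G u v k → Walk G v u k
  walk-reverse here = here
  walk-reverse {u} {v} (step {k = k} e p) =
    subst (Walk G v u) (ℕₚ.+-comm k 1) (walk-++ (walk-reverse p) (step (adj-sym e) here))

  Within : ℕ → Fin n → Fin n → Set
  Within r u v = ∃ λ l → l ≤ r × Walk G u v l

  within-trans : ∀ {r s u v w} → Within r u v → Within s v w → Within (r + s) u w
  within-trans (_ , k≤r , p) (_ , l≤s , q) = _ , ℕₚ.+-mono-≤ k≤r l≤s , walk-++ p q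

  within-sym : ∀ {r u v} → Within r u v → Within r v u
  within-sym (_ , k≤r , p) = _ , k≤r , walk-reverse p

  within-mono : ∀ {r s u v} → r ≤ s → Within r u v → Within s u v
  within-mono r≤s (_ , k≤r , p) = _ , ℕₚ.≤-trans k≤r r≤s , p

  within-refl : ∀ {r u} → Within r u u
  within-refl = 0 , z≤n , here

∨-trueʳ : ∀ {a b} → b ≡ true → a ∨ b ≡ true
∨-trueʳ {a} refl = ∨-zeroʳ a

∨-trueˡ : ∀ {a b} → a ≡ true → a ∨ b ≡ true
∨-trueˡ refl = refl

anyF-intro : ∀ {n} (p : Fin n → Bool) x → p x ≡ true → anyF p ≡ true
anyF-intro {n} p x px = go id x px
  where
  go : ∀ {m} (g : Fin m → Fin n) x → p (g x) ≡ true → foldr (λ x acc → p x ∨ acc) false (tabulate g) ≡ true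
  go g Fin.zero    px = ∨-trueˡ px
  go g (Fin.suc x) px = ∨-trueʳ (go (g ∘ Fin.suc) x px)

anyF-elim : ∀ {n} (p : Fin n → Bool) → anyF p ≡ true → ∃ λ x → p x ≡ true
anyF-elim {n} p = go id
  where
  go : ∀ {m} (g : Fin m → Fin n) → foldr (λ x acc → p x ∨ acc) false (tabulate g) ≡ true → ∃ λ x → p x ≡ true
  go {suc m} g e with p (g Fin.zero) in eq
  ... | true  = g Fin.zero , eq
  ... | false = go (g ∘ Fin.suc) e

module _ {n : ℕ} (G : Graph n) where

  reach-walk : ∀ k {t u v l} → reach G k t u ≡ true → Walk G u v l → reach G (k + l) t v ≡ true
  reach-walk k {t} {u} r here = subst (λ z → reach G z t u ≡ true) (≡.sym (ℕₚ.+-identityʳ k)) r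
  reach-walk k {t} {u} {v} r (step {w = w} {k = l} e p) = subst (λ z → reach G z t v ≡ true) (≡.sym (ℕₚ.+-suc k l))
    (reach-walk (suc k) (∨-trueʳ (anyF-intro (λ w → reach G k t w ∧ adj G w _) u (cong₂ _∧_ r e))) p)

  -- The search cannot pass `l`, where its test succeeds; running out of fuel earlier only lowers
  -- the result.
  distFrom≤ : ∀ {u v l} → reach G l u v ≡ true → ∀ k fuel → k ≤ l → distFrom G k fuel u v ≤ l
  distFrom≤ r k zero k≤l = k≤l
  distFrom≤ {u} {v} {l} r k (suc fuel) k≤l with reach G k u v in eq
  ... | true  = k≤l
  ... | false = distFrom≤ r (suc k) fuel (ℕₚ.≤∧≢⇒< k≤l λ { refl → true≢false r eq })

  dist≤ : ∀ {r u v} → Within {G = G} r u v → dist G u v ≤ r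
  dist≤ {u = u} (l , l≤r , p) = ℕₚ.≤-trans
    (distFrom≤ (reach-walk 0 (isYes-true (u Finₚ.≟ u) refl) p) 0 n z≤n) l≤r

  module _ (φ : Fin n → ℕ) (φ-step : ∀ {x y} → Adj G x y → φ y ≤ suc (φ x)) where

    φ≤reach : ∀ {u} → φ u ≡ 0 → ∀ k v → reach G k u v ≡ true → φ v ≤ k
    φ≤reach {u} φu zero v r with u Finₚ.≟ v
    ... | yes refl = ℕₚ.≤-reflexive φu
    φ≤reach φu zero v () | no _
    φ≤reach {u} φu (suc k) v r with reach G k u v in eq
    ... | true  = ℕₚ.m≤n⇒m≤1+n (φ≤reach φu k v eq)
    ... | false with anyF-elim (λ w → reach G k u w ∧ adj G w v) r
    ...   | w , e with reach G k u w in eq′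
    ...     | true = ℕₚ.≤-trans (φ-step e) (s≤s (φ≤reach φu k w eq′))

    φ≤distFrom : ∀ {u} → φ u ≡ 0 → ∀ v k fuel → φ v ≤ k + fuel → φ v ≤ distFrom G k fuel u v
    φ≤distFrom φu v k zero h = subst (φ v ≤_) (ℕₚ.+-identityʳ k) h
    φ≤distFrom {u} φu v k (suc fuel) h with reach G k u v in eq
    ... | true  = φ≤reach φu k v eq
    ... | false = φ≤distFrom φu v (suc k) fuel (subst (φ v ≤_) (ℕₚ.+-suc k fuel) h)

    -- Each round of `reach` raises φ by at most one. The hypothesis `φ v ≤ n` covers the default
    -- value n returned when the fuel is exhausted.
    φ≤dist : ∀ {u} v → φ u ≡ 0 → φ v ≤ n → φ v ≤ dist G u v
    φ≤dist v φu h = φ≤distFrom φu v 0 n h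

  ecc≤ : ∀ {r u} → (∀ v → Within {G = G} r u v) → ecc G u ≤ r
  ecc≤ {r} {u} near = go id
    where
    go : ∀ {m} (g : Fin m → Fin n) → foldr (λ v acc → dist G u v ℕ.⊔ acc) 0 (tabulate g) ≤ r
    go {zero}  g = z≤n
    go {suc m} g = ℕₚ.⊔-lub (dist≤ (near (g Fin.zero))) (go (g ∘ Fin.suc))

  dist≤ecc : ∀ u v → dist G u v ≤ ecc G u
  dist≤ecc u v = go id v
    where
    go : ∀ {m} (g : Fin m → Fin n) v → dist G u (g v) ≤ foldr (λ v acc → dist G u v ℕ.⊔ acc) 0 (tabulate g)
    go g Fin.zero    = ℕₚ.m≤m⊔n _ _
    go g (Fin.suc v) = ℕₚ.≤-trans (go (g ∘ Fin.suc) v) (ℕₚ.m≤n⊔m _ _)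

module _ {n : ℕ} (G : Graph (suc n)) where

  radius≤ecc : ∀ u → radius G ≤ ecc G u
  radius≤ecc u = go id u
    where
    go : ∀ {m} (g : Fin m → Fin (suc n)) u →
      foldr (λ u acc → ecc G u ℕ.⊓ acc) (ecc G Fin.zero) (tabulate g) ≤ ecc G (g u)
    go g Fin.zero    = ℕₚ.m⊓n≤m _ _
    go g (Fin.suc u) = ℕₚ.≤-trans (ℕₚ.m⊓n≤n _ _) (go (g ∘ Fin.suc) u)

  ≤radius : ∀ {r} → (∀ u → r ≤ ecc G u) → r ≤ radius G
  ≤radius {r} r≤ecc = go id
    where
    go : ∀ {m} (g : Fin m → Fin (suc n)) → r ≤ foldr (λ u acc → ecc G u ℕ.⊓ acc) (ecc G Fin.zero) (tabulate g)
    go {zero}  g = r≤ecc Fin.zero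
    go {suc m} g = ℕₚ.⊓-glb (r≤ecc (g Fin.zero)) (go (g ∘ Fin.suc))

  radius≤ : ∀ {r} u → (∀ v → Within {G = G} r u v) → radius G ≤ r
  radius≤ u near = ℕₚ.≤-trans (radius≤ecc u) (ecc≤ G near)

-- A non-cycle edge of a unicyclic graph is a bridge

module _ {n : ℕ} (R : Fin n → Fin n → Set) where

  record Path (l : ℕ) (u v : Fin n) : Set where
    field
      at    : Fin (suc l) → Fin n
      at-inj : Injective _≡_ _≡_ at
      at-step : ∀ i → R (at (inject₁ i)) (at (Fin.suc i))
      start : at Fin.zero ≡ u
      end   : at (fromℕ l) ≡ v

  suffix : ∀ {l v} (p : Fin (suc l) → Fin n) → Injective _≡_ _≡_ p →
    (∀ i → R (p (inject₁ i)) (p (Fin.suc i))) → p (fromℕ l) ≡ v → ∀ i → ∃ λ l′ → Path l′ (p i) v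
  suffix p inj cons end Fin.zero = _ , record { at = p ; at-inj = inj ; at-step = cons ; start = refl ; end = end }
  suffix {suc l} p inj cons end (Fin.suc i) =
    suffix (p ∘ Fin.suc) (Finₚ.suc-injective ∘ inj) (cons ∘ Fin.suc) end i

  extend : ∀ {l u w v} → R u w → (p : Path l w v) → (∀ i → Path.at p i ≢ u) → Path (suc l) u v
  extend {l} {u} r p fresh = record
    { at = at′ ; at-inj = λ {i} {j} → inj′ {i} {j} ; at-step = cons′ ; start = refl ; end = end }
    where
    open Path p
    at′ : Fin (suc (suc l)) → Fin n
    at′ Fin.zero    = u
    at′ (Fin.suc i) = at i
    inj′ : Injective _≡_ _≡_ at′
    inj′ {Fin.zero}  {Fin.zero}  e = refl
    inj′ {Fin.zero}  {Fin.suc j} e = ⊥-elim (fresh j (≡.sym e))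
    inj′ {Fin.suc i} {Fin.zero}  e = ⊥-elim (fresh i e)
    inj′ {Fin.suc i} {Fin.suc j} e = cong Fin.suc (at-inj e)
    cons′ : ∀ i → R (at′ (inject₁ i)) (at′ (Fin.suc i))
    cons′ Fin.zero    = subst (R u) (≡.sym start) r
    cons′ (Fin.suc i) = at-step i

  -- If `u` occurs on the loop-erased rest, everything before that occurrence is dropped. The result
  -- has the distinct vertices that `Cycle` asks for.
  loopErase : ∀ {u v} → Star R u v → ∃ λ l → Path l u v
  loopErase {u} ε = 0 , record
    { at = λ _ → u ; at-inj = λ { {Fin.zero} {Fin.zero} _ → refl } ; at-step = λ () ; start = refl ; end = refl }
  loopErase {u} {v} (r ◅ rs) with loopErase rs
  ... | l , p with Finₚ.any? (λ i → Path.at p i Finₚ.≟ u)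
  ...   | yes (i , e) = subst (λ z → ∃ λ l′ → Path l′ z v) e (suffix (Path.at p) (Path.at-inj p) (Path.at-step p) (Path.end p) i)
  ...   | no fresh    = suc l , extend r p (λ i e → fresh (i , e))

  star-along : ∀ {q} (γ : Fin (suc q) → Fin n) → (∀ i → R (γ (inject₁ i)) (γ (Fin.suc i))) →
    ∀ i → Star R (γ Fin.zero) (γ i)
  star-along γ cons Fin.zero = ε
  star-along {suc q} γ cons (Fin.suc i) = cons Fin.zero ◅ star-along (γ ∘ Fin.suc) (cons ∘ Fin.suc) i

Avoiding : ∀ {n} → Graph n → Fin n → Fin n → Fin n → Fin n → Set
Avoiding G u v x y = Adj G x y × ¬ (x ≡ u × y ≡ v) × ¬ (x ≡ v × y ≡ u)

avoiding-sym : ∀ {n} (G : Graph n) {u v x y} → Avoiding G u v x y → Avoiding G u v y x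
avoiding-sym G (e , a , b) = adj-sym {G = G} e , (λ (p , q) → b (q , p)) , (λ (p , q) → a (q , p))

-- A loop-erased walk around the edge closes up with it to a cycle through `u` and `v`, whose edges
-- are those of `C` by uniqueness. Length 0 would make the edge a loop and length 1 would use the
-- avoided edge, so at least three vertices remain.
bridge : ∀ {n} (G : Graph n) → (∀ (C C′ : Cycle G) u v → CycleEdge C u v ⇔ CycleEdge C′ u v) →
  (C : Cycle G) → ∀ {u v} → Adj G u v → ¬ CycleEdge C u v → ¬ Star (Avoiding G u v) u v
bridge G uniq C {u} {v} uv ∉C walk with loopErase (Avoiding G u v) walk
... | 0 , p rewrite ≡.sym (Path.start p) | ≡.sym (Path.end p) = true≢false uv (irr G _)
... | 1 , p = proj₁ (proj₂ (Path.at-step p Fin.zero)) (Path.start p , Path.end p)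
... | suc (suc l) , p = ∉C (Equivalence.from (uniq C C′ u v) (inj₂ (inj₂ (Path.end p , Path.start p))))
  where
  C′ : Cycle G
  C′ = record { m = l ; vtx = Path.at p ; inj = Path.at-inj p ; cons = proj₁ ∘ Path.at-step p
              ; close = ≡.subst₂ (Adj G) (≡.sym (Path.end p)) (≡.sym (Path.start p)) (adj-sym {G = G} uv) }

-- Least witnesses and maxima

least : ∀ {P : ℕ → Set} → (∀ k → Dec (P k)) → ∀ l → P l → ∃ λ k → P k × (∀ j → j < k → ¬ P j)
least P? zero p = 0 , p , λ _ ()
least P? (suc l) p with P? 0
... | yes p₀ = 0 , p₀ , λ _ ()
... | no ¬p₀ with least (P? ∘ suc) l p
...   | k , pk , min = suc k , pk , λ { zero _ p₀ → ¬p₀ p₀ ; (suc j) (s≤s j<k) → min j j<k }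

argmax : ∀ {n} (f : Fin (suc n) → ℕ) → ∃ λ i → ∀ j → f j ≤ f i
argmax {zero} f = Fin.zero , λ { Fin.zero → ℕₚ.≤-refl }
argmax {suc n} f with argmax (f ∘ Fin.suc)
... | i , max with ℕₚ.≤-total (f Fin.zero) (f (Fin.suc i))
...   | inj₁ le = Fin.suc i , λ { Fin.zero → le ; (Fin.suc j) → max j }
...   | inj₂ ge = Fin.zero , λ { Fin.zero → ℕₚ.≤-refl ; (Fin.suc j) → ℕₚ.≤-trans (max j) ge }

-- Cyclic adjacency of indices

module _ {q : ℕ} where

  private
    K : ℕ
    K = suc (suc (suc q))

  nxt : Fin K → Fin K
  nxt i with suc (toℕ i) ℕ.<? K
  ... | yes i+1<K = fromℕ< i+1<K
  ... | no  _     = Fin.zero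

  prv : Fin K → Fin K
  prv Fin.zero    = fromℕ (suc (suc q))
  prv (Fin.suc i) = inject₁ i

  nxt-adj : ∀ i → CnAdj i (nxt i)
  nxt-adj i with suc (toℕ i) ℕ.<? K
  ... | yes i+1<K = inj₁ (≡.sym (Finₚ.toℕ-fromℕ< i+1<K))
  ... | no  i+1≮K = inj₂ (inj₂ (inj₁ (ℕₚ.≤-antisym (Finₚ.toℕ<n i) (ℕₚ.≮⇒≥ i+1≮K) , refl)))

  prv-adj : ∀ i → CnAdj i (prv i)
  prv-adj Fin.zero    = inj₂ (inj₂ (inj₂ (cong suc (Finₚ.toℕ-fromℕ (suc (suc q))) , refl)))
  prv-adj (Fin.suc i) = inj₂ (inj₁ (cong suc (Finₚ.toℕ-inject₁ i)))

  CnAdj-cases : ∀ i j → CnAdj i j → j ≡ nxt i ⊎ j ≡ prv i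
  CnAdj-cases i j (inj₁ e) with suc (toℕ i) ℕ.<? K
  ... | yes i+1<K = inj₁ (Finₚ.toℕ-injective (trans (≡.sym e) (≡.sym (Finₚ.toℕ-fromℕ< i+1<K))))
  ... | no  i+1≮K = ⊥-elim (i+1≮K (subst (_< K) (≡.sym e) (Finₚ.toℕ<n j)))
  CnAdj-cases (Fin.suc i) j (inj₂ (inj₁ e)) =
    inj₂ (Finₚ.toℕ-injective (trans (ℕₚ.suc-injective e) (≡.sym (Finₚ.toℕ-inject₁ i))))
  CnAdj-cases i j (inj₂ (inj₂ (inj₁ (e , j≡0)))) with suc (toℕ i) ℕ.<? K
  ... | yes i+1<K = ⊥-elim (ℕₚ.<⇒≢ i+1<K e)
  ... | no  i+1≮K = inj₁ (Finₚ.toℕ-injective j≡0)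
  CnAdj-cases Fin.zero j (inj₂ (inj₂ (inj₂ (e , _)))) =
    inj₂ (Finₚ.toℕ-injective (trans (ℕₚ.suc-injective e) (≡.sym (Finₚ.toℕ-fromℕ (suc (suc q))))))

  nxt≢prv : ∀ i → nxt i ≢ prv i
  nxt≢prv i e with suc (toℕ i) ℕ.<? K
  nxt≢prv Fin.zero e | yes p with trans (≡.sym (Finₚ.toℕ-fromℕ< p)) (trans (cong toℕ e) (Finₚ.toℕ-fromℕ (suc (suc q))))
  ... | ()
  nxt≢prv (Fin.suc i) e | yes p = ℕₚ.<⇒≢ (ℕₚ.m<n⇒m<1+n (ℕₚ.n<1+n (toℕ i)))
    (≡.sym (trans (≡.sym (Finₚ.toℕ-fromℕ< p)) (trans (cong toℕ e) (Finₚ.toℕ-inject₁ i))))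
  nxt≢prv Fin.zero e | no _ with e
  ... | ()
  -- Index 1 would be the last one only on a cycle of two vertices; `K` is at least 3.
  nxt≢prv (Fin.suc Fin.zero) e | no ¬p = ¬p (s≤s (s≤s (s≤s z≤n)))
  nxt≢prv (Fin.suc (Fin.suc i)) e | no _ with e
  ... | ()

cycleEdge? : ∀ {n} {G : Graph n} (C : Cycle G) u v → Dec (CycleEdge C u v)
cycleEdge? C u v =
  Finₚ.any? (λ i → (vtx C (inject₁ i) Finₚ.≟ u ×-dec vtx C (Fin.suc i) Finₚ.≟ v)
             ⊎-dec (vtx C (inject₁ i) Finₚ.≟ v ×-dec vtx C (Fin.suc i) Finₚ.≟ u))
  ⊎-dec ((vtx C (fromℕ _) Finₚ.≟ u ×-dec vtx C Fin.zero Finₚ.≟ v)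
   ⊎-dec (vtx C (fromℕ _) Finₚ.≟ v ×-dec vtx C Fin.zero Finₚ.≟ u))

walk? : ∀ {n} (G : Graph n) l u v → Dec (Walk G u v l)
walk? G zero u v = map′ (λ { refl → here }) (λ { here → refl }) (u Finₚ.≟ v)
walk? G (suc l) u v = map′ (λ (w , e , p) → step e p) (λ { (step e p) → _ , e , p })
  (Finₚ.any? λ w → (adj G u w Data.Bool.≟ true) ×-dec walk? G l w v)

-- The rooted structure of a connected unicyclic graph

module Rooted {n : ℕ} (G : Graph (suc n)) (conn : Connected G)
  (uniq : ∀ (C C′ : Cycle G) u v → CycleEdge C u v ⇔ CycleEdge C′ u v) (C : Cycle G) where

  V : Set
  V = Fin (suc n)

  K : ℕ
  K = suc (suc (suc (m C)))

  γ : Fin K → V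
  γ = vtx C

  cycleEdge-index : ∀ i j → CycleEdge C (γ i) (γ j) → CnAdj i j
  cycleEdge-index i j (inj₁ (a , inj₁ (p , q))) = inj₁ (trans (cong (suc ∘ toℕ) (≡.sym (inj C p)))
    (trans (cong suc (Finₚ.toℕ-inject₁ a)) (cong toℕ (inj C q))))
  cycleEdge-index i j (inj₁ (a , inj₂ (p , q))) = inj₂ (inj₁ (trans (cong (suc ∘ toℕ) (≡.sym (inj C p)))
    (trans (cong suc (Finₚ.toℕ-inject₁ a)) (cong toℕ (inj C q)))))
  cycleEdge-index i j (inj₂ (inj₁ (p , q))) = inj₂ (inj₂ (inj₁
    (trans (cong (suc ∘ toℕ) (≡.sym (inj C p))) (cong suc (Finₚ.toℕ-fromℕ _)) , cong toℕ (≡.sym (inj C q)))))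
  cycleEdge-index i j (inj₂ (inj₂ (p , q))) = inj₂ (inj₂ (inj₂
    (trans (cong (suc ∘ toℕ) (≡.sym (inj C p))) (cong suc (Finₚ.toℕ-fromℕ _)) , cong toℕ (≡.sym (inj C q)))))

  index-adj : ∀ i j → CnAdj i j → Adj G (γ i) (γ j)
  index-adj i j (inj₁ e) = succ i j e
    where
    succ : ∀ i j → suc (toℕ i) ≡ toℕ j → Adj G (γ i) (γ j)
    succ i (Fin.suc j) e = subst (λ z → Adj G (γ z) (γ (Fin.suc j)))
      (Finₚ.toℕ-injective (trans (Finₚ.toℕ-inject₁ j) (≡.sym (ℕₚ.suc-injective e)))) (cons C j)
  index-adj i j (inj₂ (inj₁ e)) = adj-sym {G = G} (index-adj j i (inj₁ e))
  index-adj i j (inj₂ (inj₂ (inj₁ (e , j≡0)))) = ≡.subst₂ (λ x y → Adj G (γ x) (γ y))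
    (Finₚ.toℕ-injective (trans (Finₚ.toℕ-fromℕ _) (≡.sym (ℕₚ.suc-injective e))))
    (Finₚ.toℕ-injective (≡.sym j≡0)) (close C)
  index-adj i j (inj₂ (inj₂ (inj₂ e))) = adj-sym {G = G} (index-adj j i (inj₂ (inj₂ (inj₁ e))))

  ToCycle : V → ℕ → Set
  ToCycle v l = ∃ λ i → Walk G v (γ i) l

  abstract
    nearest : ∀ v → ∃ λ l → ToCycle v l × (∀ j → j < l → ¬ ToCycle v j)
    nearest v = least (λ l → Finₚ.any? λ i → walk? G l v (γ i)) _ (Fin.zero , proj₂ (conn v (γ Fin.zero)))

  δ : V → ℕ
  δ v = proj₁ (nearest v)

  δ≤ : ∀ {v l} → ToCycle v l → δ v ≤ l
  δ≤ {v} {l} w = ℕₚ.≮⇒≥ λ l<δ → proj₂ (proj₂ (nearest v)) l l<δ w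

  δ-γ : ∀ i → δ (γ i) ≡ 0
  δ-γ i = ℕₚ.n≤0⇒n≡0 (δ≤ (i , here))

  -- The empty walk yields its start, so `π` fixes every cycle vertex and iterated parents come to
  -- rest at the foot on the cycle.
  first : ∀ {u v l} → Walk G u v l → V
  first {u} here             = u
  first     (step {w = w} _ _) = w

  π : V → V
  π v = first (proj₂ (proj₁ (proj₂ (nearest v))))

  δ-adj : ∀ {u v} → Adj G u v → δ u ≤ suc (δ v)
  δ-adj {u} {v} e with proj₁ (proj₂ (nearest v))
  ... | i , w = δ≤ (i , step e w)

  on-cycle : ∀ {v} → δ v ≡ 0 → ∃ λ i → γ i ≡ v
  on-cycle {v} e with nearest v
  on-cycle {v} refl | 0 , (i , here) , _ = i , refl

  π-cycle : ∀ {v} → δ v ≡ 0 → π v ≡ v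
  π-cycle {v} e with nearest v
  π-cycle {v} refl | 0 , (i , here) , _ = refl

  π-adj : ∀ {v d} → δ v ≡ suc d → Adj G v (π v)
  π-adj {v} e with nearest v
  π-adj {v} refl | suc d , (i , step e w) , _ = e

  δ-π-suc : ∀ {v d} → δ v ≡ suc d → δ (π v) ≡ d
  δ-π-suc {v} {d} e = ℕₚ.≤-antisym (upper e)
    (ℕₚ.≤-pred (subst (_≤ suc (δ (π v))) e (δ-adj (π-adj e))))
    where
    upper : δ v ≡ suc d → δ (π v) ≤ d
    upper e with nearest v
    upper refl | suc d , (i , step e w) , _ = δ≤ (i , w)

  δ-π : ∀ v → δ (π v) ≡ pred (δ v)
  δ-π v = go (δ v) refl
    where
    go : ∀ d → δ v ≡ d → δ (π v) ≡ pred d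
    go zero    e = trans (cong δ (π-cycle e)) e
    go (suc d) e = δ-π-suc e

  -- An edge off `C` between two cycle vertices would be a bridge, but `C` itself joins its ends
  -- without using it.
  chord : ∀ {u v} → δ u ≡ 0 → δ v ≡ 0 → Adj G u v → CycleEdge C u v
  chord {u} {v} δu δv uv with cycleEdge? C u v
  ... | yes e = e
  ... | no ∉C with on-cycle δu | on-cycle δv
  ...   | i , refl | j , refl = ⊥-elim (bridge G uniq C uv ∉C
    (reverse (avoiding-sym G) (star-along R γ around i) ◅◅ star-along R γ around j))
    where
    R = Avoiding G (γ i) (γ j)
    around : ∀ a → R (γ (inject₁ a)) (γ (Fin.suc a))
    around a = cons C a , (λ e → ∉C (inj₁ (a , inj₁ e))) , (λ e → ∉C (inj₁ (a , inj₂ e)))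

  module _ {v w d} (δv : δ v ≡ suc d) (vw : Adj G v w) (δw : δ w ≤ suc d) (w≢π : w ≢ π v) where

    private
      R : V → V → Set
      R = Avoiding G v w

      off-v : ∀ {x y} → Adj G x y → x ≢ v → y ≢ v → R x y
      off-v e x≢v y≢v = e , (λ (p , _) → x≢v p) , (λ (_ , q) → y≢v q)

      δ≢ : ∀ {x} → δ x ≤ d → x ≢ v
      δ≢ δx refl = ℕₚ.<⇒≱ (s≤s δx) (ℕₚ.≤-reflexive (≡.sym δv))

      -- Parents have smaller depth, so only the start can be as deep as `v`, and it differs from
      -- `v`. The way to the cycle therefore never meets `v`.
      to-cycle : ∀ f x → δ x ≡ f → f ≤ suc d → x ≢ v → ∃ λ i → Star R x (γ i)
      to-cycle zero x δx _ _ with on-cycle δx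
      ... | i , refl = i , ε
      to-cycle (suc f) x δx (s≤s f≤d) x≢v with to-cycle f (π x) (δ-π-suc δx) (ℕₚ.m≤n⇒m≤1+n f≤d) π≢v
        where
        π≢v : π x ≢ v
        π≢v = δ≢ (subst (_≤ d) (≡.sym (δ-π-suc δx)) f≤d)
      ... | i , p = i , off-v (π-adj δx) x≢v (δ≢ (subst (_≤ d) (≡.sym (δ-π-suc δx)) f≤d)) ◅ p

      γ≢v : ∀ i → γ i ≢ v
      γ≢v i = δ≢ (subst (_≤ d) (≡.sym (δ-γ i)) z≤n)

      from-zero : ∀ i → Star R (γ Fin.zero) (γ i)
      from-zero = star-along R γ (λ a → off-v (cons C a) (γ≢v _) (γ≢v _))

      w≢v : w ≢ v
      w≢v refl = true≢false vw (irr G w)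

    -- The ways to the cycle from `π v` and from `w`, joined along `C`, lead from `v` to `w` around
    -- their edge. That edge is off `C` because `v` is, so it should have been a bridge.
    second-parent : ⊥
    second-parent with to-cycle d (π v) (δ-π-suc δv) (ℕₚ.n≤1+n d) (δ≢ (ℕₚ.≤-reflexive (δ-π-suc δv)))
                     | to-cycle (δ w) w refl δw w≢v
    ... | i , p | j , q = bridge G uniq C vw ∉C
      ((π-adj δv , (λ (_ , e) → w≢π (≡.sym e)) , (λ (e , _) → w≢v (≡.sym e)))
        ◅ p ◅◅ reverse (avoiding-sym G) (from-zero i) ◅◅ from-zero j ◅◅ reverse (avoiding-sym G) q)
      where
      ∉C : ¬ CycleEdge C v w
      ∉C (inj₁ (a , inj₁ (e , _))) = γ≢v _ e
      ∉C (inj₁ (a , inj₂ (_ , e))) = γ≢v _ e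
      ∉C (inj₂ (inj₁ (e , _)))     = γ≢v _ e
      ∉C (inj₂ (inj₂ (_ , e)))     = γ≢v _ e

  parent-unique : ∀ {v w d} → δ v ≡ suc d → Adj G v w → δ w ≤ suc d → w ≡ π v
  parent-unique {v} {w} δv vw δw with w Finₚ.≟ π v
  ... | yes e = e
  ... | no ≢  = ⊥-elim (second-parent δv vw δw ≢)

  -- Read from the deeper end: if it is off the cycle, the other end is its parent by
  -- `parent-unique`; if it is on the cycle, so is the other, and `chord` applies.
  edge-classify : ∀ {u v} → Adj G u v →
    CycleEdge C u v ⊎ (0 < δ u × v ≡ π u) ⊎ (0 < δ v × u ≡ π v)
  edge-classify {u} {v} uv with ℕₚ.≤-total (δ v) (δ u)
  ... | inj₁ v≤u = go (δ u) refl
    where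
    go : ∀ d → δ u ≡ d → CycleEdge C u v ⊎ (0 < δ u × v ≡ π u) ⊎ (0 < δ v × u ≡ π v)
    go zero    δu = inj₁ (chord δu (ℕₚ.n≤0⇒n≡0 (subst (δ v ≤_) δu v≤u)) uv)
    go (suc d) δu = inj₂ (inj₁ (subst (0 <_) (≡.sym δu) (s≤s z≤n) , parent-unique δu uv (subst (δ v ≤_) δu v≤u)))
  ... | inj₂ u≤v = go (δ v) refl
    where
    go : ∀ d → δ v ≡ d → CycleEdge C u v ⊎ (0 < δ u × v ≡ π u) ⊎ (0 < δ v × u ≡ π v)
    go zero    δv = inj₁ (chord (ℕₚ.n≤0⇒n≡0 (subst (δ u ≤_) δv u≤v)) δv uv)
    go (suc d) δv = inj₂ (inj₂ (subst (0 <_) (≡.sym δv) (s≤s z≤n) ,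
      parent-unique δv (adj-sym {G = G} uv) (subst (δ u ≤_) δv u≤v)))

  cycle-nbr : ∀ i v → Adj G (γ i) v → δ v ≡ 0 → ∃ λ j → γ j ≡ v × CnAdj i j
  cycle-nbr i v e δv with on-cycle δv
  ... | j , refl = j , refl , cycleEdge-index i j (chord (δ-γ i) δv e)

-- Growing parent-closed sets

cnt-image : ∀ {n k} (p : Fin n → Bool) (γ : Fin k → Fin n) → Injective _≡_ _≡_ γ →
  (∀ i → p (γ i) ≡ true) → (∀ x → p x ≡ true → ∃ λ i → γ i ≡ x) → cnt p ≡ k
cnt-image {k = zero}  p γ inj hit cover = cnt-none (all-false λ j pj → case cover j pj of λ ())
cnt-image {k = suc k} p γ inj hit cover = trans (cnt-remove p (γ Fin.zero) (hit Fin.zero))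
  (cong suc (cnt-image (p ∖ γ Fin.zero) (γ ∘ Fin.suc) (Finₚ.suc-injective ∘ inj)
    (λ i → ∖-≢ p (hit (Fin.suc i)) (λ e → case inj e of λ ())) cover′))
  where
  cover′ : ∀ x → (p ∖ γ Fin.zero) x ≡ true → ∃ λ i → γ (Fin.suc i) ≡ x
  cover′ x e with ∖-true p e
  ... | px , x≢γ₀ with cover x px
  ...   | Fin.zero  , γ₀≡x = ⊥-elim (x≢γ₀ (≡.sym γ₀≡x))
  ...   | Fin.suc i , γᵢ≡x = i , γᵢ≡x

ℤ-sum-if : ∀ {n} (p : Fin n → Bool) c → ℤΣ.sum (λ j → if p j then + c else ℤ.0ℤ) ≡ + (c * cnt p)
ℤ-sum-if {n} p c = trans (go p) (cong (λ z → + (c * z)) (≡.sym (cnt-sum p)))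
  where
  go : ∀ {m} (p : Fin m → Bool) → ℤΣ.sum (λ j → if p j then + c else ℤ.0ℤ) ≡ + (c * ℕΣ.sum (bit ∘ p))
  go {zero}  p = cong (λ z → + z) (≡.sym (ℕₚ.*-zeroʳ c))
  go {suc m} p with p Fin.zero
  ... | true  = trans (cong (λ z → + c ℤ.+ z) (go (p ∘ Fin.suc)))
                      (cong (λ z → + z) (≡.sym (ℕₚ.*-suc c (ℕΣ.sum (bit ∘ p ∘ Fin.suc)))))
  ... | false = trans (ℤₚ.+-identityˡ _) (go (p ∘ Fin.suc))

module Growth {n : ℕ} (G : Graph (suc n)) (conn : Connected G)
  (uniq : ∀ (C C′ : Cycle G) u v → CycleEdge C u v ⇔ CycleEdge C′ u v) (C : Cycle G) where

  open Rooted G conn uniq C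

  up : ℕ → V → V
  up zero    v = v
  up (suc j) v = π (up j v)

  δ-up : ∀ j v → δ (up j v) ≡ δ v ∸ j
  δ-up zero    v = refl
  δ-up (suc j) v = trans (δ-π (up j v)) (trans (cong pred (δ-up j v)) (ℕₚ.pred[m∸n]≡m∸[1+n] (δ v) j))

  π-adj⁺ : ∀ {v} → 0 < δ v → Adj G v (π v)
  π-adj⁺ {v} 0<δ = π-adj (≡.sym (ℕₚ.suc-pred (δ v) {{ℕ.>-nonZero 0<δ}}))

  δ-π-< : ∀ {v} → 0 < δ v → δ (π v) < δ v
  δ-π-< {v} 0<δ = subst (_< δ v) (≡.sym (δ-π v)) (ℕₚ.≤-reflexive (ℕₚ.suc-pred (δ v) {{ℕ.>-nonZero 0<δ}}))

  record Closed (σ : V → Bool) : Set where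
    field
      cyc : ∀ i → σ (γ i) ≡ true
      par : ∀ v → σ v ≡ true → σ (π v) ≡ true

    outside : ∀ {v} → σ v ≡ false → 0 < δ v
    outside {v} σv = ℕₚ.n≢0⇒n>0 λ δv → true≢false (subst (λ z → σ z ≡ true) (proj₂ (on-cycle δv)) (cyc _)) σv

    on-cycle-edge : ∀ {u v} → CycleEdge C u v → σ u ≡ true × σ v ≡ true
    on-cycle-edge (inj₁ (i , inj₁ (refl , refl))) = cyc _ , cyc _
    on-cycle-edge (inj₁ (i , inj₂ (refl , refl))) = cyc _ , cyc _
    on-cycle-edge (inj₂ (inj₁ (refl , refl)))     = cyc _ , cyc _
    on-cycle-edge (inj₂ (inj₂ (refl , refl)))     = cyc _ , cyc _

    par-adj : ∀ v → σ v ≡ false → Adj G v (π v)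
    par-adj v σv = π-adj⁺ (outside σv)

    par-asym : ∀ i j → σ i ≡ false → σ j ≡ false → j ≡ π i → i ≡ π j → ⊥
    par-asym i j σi σj j≡ i≡ = ℕₚ.<-asym (below σi j≡) (below σj i≡)
      where
      below : ∀ {x y} → σ x ≡ false → y ≡ π x → δ y < δ x
      below σx refl = δ-π-< (outside σx)

    edge-cases : ∀ i j → Adj G i j → (σ i ≡ true × σ j ≡ true)
       ⊎ (σ i ≡ false × j ≡ π i) ⊎ (σ j ≡ false × i ≡ π j)
    edge-cases i j e with edge-classify e
    ... | inj₁ c = inj₁ (on-cycle-edge c)
    ... | inj₂ (inj₁ (_ , refl)) with σ i in σi
    ...   | true  = inj₁ (refl , par i σi)
    ...   | false = inj₂ (inj₁ (refl , refl))
    edge-cases i j e | inj₂ (inj₂ (_ , refl)) with σ j in σj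
    ...   | true  = inj₁ (par j σj , refl)
    ...   | false = inj₂ (inj₂ (refl , refl))

    bound : twentieths (budget G σ) ℚ.≤ harmonic G
    bound = Discharge.budget≤harmonic G σ π par-adj par-asym edge-cases

  σ₀ : V → Bool
  σ₀ v = ⌊ δ v ℕ.≟ 0 ⌋

  σ₀-true : ∀ {v} → σ₀ v ≡ true → δ v ≡ 0
  σ₀-true {v} e with δ v ℕ.≟ 0
  ... | yes δv = δv
  σ₀-true () | no _

  σ₀-closed : Closed σ₀
  σ₀-closed = record
    { cyc = λ i → isYes-true (δ (γ i) ℕ.≟ 0) (δ-γ i)
    ; par = λ v σv → isYes-true (δ (π v) ℕ.≟ 0) (trans (δ-π v) (cong pred (σ₀-true σv))) }

  inner-σ₀ : ∀ i → inner G σ₀ (γ i) ≡ 2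
  inner-σ₀ i = cnt-two _ (γ (nxt i)) (γ (prv i)) (nxt≢prv i ∘ inj C)
    (cong₂ _∧_ (index-adj i (nxt i) (nxt-adj i)) (Closed.cyc σ₀-closed (nxt i)))
    (cong₂ _∧_ (index-adj i (prv i) (prv-adj i)) (Closed.cyc σ₀-closed (prv i)))
    only
    where
    only : ∀ j → adj G (γ i) j ∧ σ₀ j ≡ true → j ≡ γ (nxt i) ⊎ j ≡ γ (prv i)
    only v e with adj G (γ i) v in a | σ₀ v in s
    ... | true | true with cycle-nbr i v a (σ₀-true s)
    ...   | j , refl , c with CnAdj-cases i j c
    ...     | inj₁ refl = inj₁ refl
    ...     | inj₂ refl = inj₂ refl

  cnt-σ₀ : cnt σ₀ ≡ K
  cnt-σ₀ = cnt-image σ₀ γ (inj C) (Closed.cyc σ₀-closed) (λ x e → on-cycle (σ₀-true e))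

  budget-σ₀ : budget G σ₀ ≡ + (10 * K)
  budget-σ₀ = trans (ℤΣ.sum-cong-≗ ten) (trans (ℤ-sum-if σ₀ 10) (cong (λ z → + (10 * z)) cnt-σ₀))
    where
    ten : ∀ v → (if σ₀ v then weight (inner G σ₀ v) else ℤ.0ℤ) ≡ (if σ₀ v then + 10 else ℤ.0ℤ)
    ten v with σ₀ v in s
    ... | false = refl
    ... | true with on-cycle (σ₀-true s)
    ...   | i , refl = cong weight (inner-σ₀ i)

  _⊕_ : (V → Bool) → V → V → Bool
  (σ ⊕ v) j = σ j ∨ (j ≟ᵇ v)

  ⊕-elim : ∀ σ {v x} → (σ ⊕ v) x ≡ true → σ x ≡ true ⊎ x ≡ v
  ⊕-elim σ {v} {x} e with σ x | x Finₚ.≟ v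
  ... | true  | _        = inj₁ refl
  ... | false | yes x≡v  = inj₂ x≡v
  ⊕-elim σ () | false | no _

  ⊕-old : ∀ σ {v x} → σ x ≡ true → (σ ⊕ v) x ≡ true
  ⊕-old σ e = ∨-trueˡ e

  ⊕-new : ∀ σ v → (σ ⊕ v) v ≡ true
  ⊕-new σ v = ∨-trueʳ {σ v} (≟ᵇ-refl v)

  ⊕-≢ : ∀ σ {v x} → x ≢ v → (σ ⊕ v) x ≡ σ x
  ⊕-≢ σ {v} {x} x≢v rewrite ≟ᵇ-≢ x≢v with σ x
  ... | true  = refl
  ... | false = refl

  module AddLeaf {σ : V → Bool} (cl : Closed σ) (v : V) (σv : σ v ≡ false) (σu : σ (π v) ≡ true) where
    open Closed cl

    u : V
    u = π v

    σ′ : V → Bool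
    σ′ = σ ⊕ v

    closed′ : Closed σ′
    closed′ = record { cyc = λ i → ⊕-old σ (cyc i) ; par = par′ }
      where
      par′ : ∀ x → σ′ x ≡ true → σ′ (π x) ≡ true
      par′ x e with ⊕-elim σ e
      ... | inj₁ σx   = ⊕-old σ (par x σx)
      ... | inj₂ refl = ⊕-old σ σu

    nbr-v : ∀ {x} → σ x ≡ true → Adj G x v → x ≡ u
    nbr-v {x} σx e with edge-cases x v e
    ... | inj₁ (_ , σv′)          = ⊥-elim (true≢false σv′ σv)
    ... | inj₂ (inj₁ (σx′ , _))   = ⊥-elim (true≢false σx σx′)
    ... | inj₂ (inj₂ (_ , x≡u))   = x≡u

    v≢u : v ≢ u
    v≢u v≡u = true≢false (subst (λ z → σ z ≡ true) (≡.sym v≡u) σu) σv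

    inner-v : inner G σ′ v ≡ 1
    inner-v = cnt-one _ u (cong₂ _∧_ (par-adj v σv) (⊕-old σ σu)) only
      where
      only : ∀ j → adj G v j ∧ σ′ j ≡ true → j ≡ u
      only j e with adj G v j in a | σ′ j in s
      ... | true | true with ⊕-elim σ {v} {j} s
      ...   | inj₁ σj   = nbr-v σj (adj-sym {G = G} a)
      ...   | inj₂ refl = ⊥-elim (true≢false a (irr G v))

    inner-u : inner G σ′ u ≡ suc (inner G σ u)
    inner-u = trans (cnt-remove _ v (cong₂ _∧_ (adj-sym {G = G} (par-adj v σv)) (⊕-new σ v)))
      (cong suc (cnt-cong same))
      where
      same : ∀ j → ((λ j → adj G u j ∧ σ′ j) ∖ v) j ≡ adj G u j ∧ σ j
      same j with j Finₚ.≟ v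
      ... | yes refl rewrite σv | ∧-zeroʳ (adj G u j) = ∧-zeroʳ (adj G u j ∧ true)
      ... | no j≢v with σ j
      ...   | true  = ∧-identityʳ _
      ...   | false = ∧-identityʳ _

    inner-other : ∀ x → σ x ≡ true → x ≢ u → inner G σ′ x ≡ inner G σ x
    inner-other x σx x≢u = cnt-cong same
      where
      same : ∀ j → adj G x j ∧ σ′ j ≡ adj G x j ∧ σ j
      same j = go (j Finₚ.≟ v)
        where
        go : Dec (j ≡ v) → adj G x j ∧ σ′ j ≡ adj G x j ∧ σ j
        go (no j≢v) = cong (adj G x j ∧_) (⊕-≢ σ j≢v)
        go (yes refl) with adj G x j in a
        ... | false = refl
        ... | true  = ⊥-elim (x≢u (nbr-v σx a))

    term : (V → Bool) → V → ℤ
    term τ i = if τ i then weight (inner G τ i) else ℤ.0ℤ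

    -- The summands of the two budgets differ at `v` and at `u`; this intermediate function lets
    -- them change one place at a time.
    mid : V → ℤ
    mid i = if i ≟ᵇ v then term σ′ i else term σ i

    -- The leaf brings `weight 1` = 7, and the change at its parent from s to s + 1 brings 7 - 4s.
    budget′ : budget G σ′ ≡ budget G σ ℤ.+ (+ 14 ℤ.- + 4 ℤ.* + inner G σ u)
    budget′ = combine {B = budget G σ} {B′ = budget G σ′} {S = + inner G σ u} {M = ℤΣ.sum mid}
      (trans (cong (λ z → ℤΣ.sum mid ℤ.+ z) (≡.sym (if-false σv)))
        (trans (ℤ-sum-update mid (term σ) v (λ j j≢v → if-false (≟ᵇ-≢ j≢v)))
          (cong (λ z → budget G σ ℤ.+ z) (trans (if-true (≟ᵇ-refl v)) (trans (if-true (⊕-new σ v)) (cong weight inner-v))))))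
      (trans (cong (λ z → budget G σ′ ℤ.+ z) (≡.sym (trans (if-false (≟ᵇ-≢ (v≢u ∘ ≡.sym))) (if-true σu))))
        (trans (ℤ-sum-update (term σ′) mid u (λ j j≢u → ≡.sym (agree j j≢u (j Finₚ.≟ v))))
          (cong (λ z → ℤΣ.sum mid ℤ.+ z) (trans (if-true (⊕-old σ σu)) (cong weight inner-u)))))
      where
      agree : ∀ j → j ≢ u → Dec (j ≡ v) → mid j ≡ term σ′ j
      agree j j≢u (yes refl) = if-true (≟ᵇ-refl j)
      agree j j≢u (no j≢v) = trans (if-false (≟ᵇ-≢ j≢v)) (go (σ j) refl)
        where
        go : ∀ b → σ j ≡ b → term σ j ≡ term σ′ j
        go true  σj = trans (if-true σj) (trans (cong weight (≡.sym (inner-other j σj j≢u))) (≡.sym (if-true (⊕-old σ σj))))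
        go false σj = trans (if-false σj) (≡.sym (if-false (trans (⊕-≢ σ j≢v) σj)))
      combine : ∀ {B B′ S M} → M ℤ.+ ℤ.0ℤ ≡ B ℤ.+ + 7 →
        B′ ℤ.+ S ℤ.* (+ 9 ℤ.- + 2 ℤ.* S) ≡ M ℤ.+ (+ 1 ℤ.+ S) ℤ.* (+ 9 ℤ.- + 2 ℤ.* (+ 1 ℤ.+ S)) →
        B′ ≡ B ℤ.+ (+ 14 ℤ.- + 4 ℤ.* S)
      combine {B} {B′} {S} {M} e₁ e₂ = begin
        B′                                             ≡⟨ r₁ B′ S ⟩
        B′ ℤ.+ S ℤ.* (+ 9 ℤ.- + 2 ℤ.* S) ℤ.- S ℤ.* (+ 9 ℤ.- + 2 ℤ.* S)
                                                       ≡⟨ cong (ℤ._- S ℤ.* (+ 9 ℤ.- + 2 ℤ.* S)) e₂ ⟩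
        M ℤ.+ (+ 1 ℤ.+ S) ℤ.* (+ 9 ℤ.- + 2 ℤ.* (+ 1 ℤ.+ S)) ℤ.- S ℤ.* (+ 9 ℤ.- + 2 ℤ.* S)
                                                       ≡⟨ r₂ M S ⟩
        (M ℤ.+ ℤ.0ℤ) ℤ.+ (+ 7 ℤ.- + 4 ℤ.* S)           ≡⟨ cong (ℤ._+ (+ 7 ℤ.- + 4 ℤ.* S)) e₁ ⟩
        (B ℤ.+ + 7) ℤ.+ (+ 7 ℤ.- + 4 ℤ.* S)            ≡⟨ r₃ B S ⟩
        B ℤ.+ (+ 14 ℤ.- + 4 ℤ.* S)                     ∎
        where
        open ≡-Reasoning
        r₁ : ∀ B′ S → B′ ≡ B′ ℤ.+ S ℤ.* (+ 9 ℤ.- + 2 ℤ.* S) ℤ.- S ℤ.* (+ 9 ℤ.- + 2 ℤ.* S)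
        r₁ = ℤSolver.solve-∀
        r₂ : ∀ M S → M ℤ.+ (+ 1 ℤ.+ S) ℤ.* (+ 9 ℤ.- + 2 ℤ.* (+ 1 ℤ.+ S)) ℤ.- S ℤ.* (+ 9 ℤ.- + 2 ℤ.* S)
           ≡ (M ℤ.+ ℤ.0ℤ) ℤ.+ (+ 7 ℤ.- + 4 ℤ.* S)
        r₂ = ℤSolver.solve-∀
        r₃ : ∀ B S → (B ℤ.+ + 7) ℤ.+ (+ 7 ℤ.- + 4 ℤ.* S) ≡ B ℤ.+ (+ 14 ℤ.- + 4 ℤ.* S)
        r₃ = ℤSolver.solve-∀

  -- The new vertices are the first `p` iterated parents of `a`, starting with `a` itself, and the
  -- foot is `up p a`. `same` keeps the other cycle vertices ready for further chains; `bounded`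
  -- controls inner degrees for a second chain that may hang on the first.
  record Grown (σ : V → Bool) (p : ℕ) (a : V) (gain : ℤ) : Set where
    field
      τ        : V → Bool
      closed   : Closed τ
      old      : ∀ {x} → σ x ≡ true → τ x ≡ true
      new      : ∀ {x} → τ x ≡ true → σ x ≡ true ⊎ ∃ λ j → j < p × x ≡ up j a
      value    : budget G τ ≡ budget G σ ℤ.+ gain
      same     : ∀ x → σ x ≡ true → x ≢ up p a → inner G τ x ≡ inner G σ x
      bounded  : ∀ {c} → 2 ≤ c → (∀ x → σ x ≡ true → x ≢ up p a → inner G σ x ≤ c) →
                 inner G σ (up p a) < c → ∀ x → τ x ≡ true → inner G τ x ≤ c

  abstract
    mutual
      -- The chain is built from its foot outwards, one leaf at a time. Only the first leaf pays for
      -- a branching; each further one hangs on a tip of inner degree 1 and brings 14 - 4 = 10.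
      grow : ∀ {σ} → Closed σ → ∀ q a → σ (up (suc q) a) ≡ true → (∀ j → j < suc q → σ (up j a) ≡ false) →
        Grown σ (suc q) a (+ (10 * suc q) ℤ.+ (+ 4 ℤ.- + 4 ℤ.* + inner G σ (up (suc q) a)))
      grow {σ} cl q a top fresh = record
        { τ       = τ
        ; closed  = closed
        ; old     = λ σx → old (⊕-old σ σx)
        ; new     = new′
        ; value   = trans value (trans (cong (λ z → z ℤ.+ + (10 * q)) budget′)
                      (trans (r (budget G σ) (+ inner G σ u) (+ (10 * q)))
                        (cong (λ z → budget G σ ℤ.+ (+ z ℤ.+ (+ 4 ℤ.- + 4 ℤ.* + inner G σ u))) (≡.sym (ℕₚ.*-suc 10 q)))))
        ; same    = λ x σx x≢u → trans (same x (⊕-old σ σx) (x≢v σx)) (inner-other x σx x≢u)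
        ; bounded = λ 2≤c small u<c → bounded 2≤c (small′ small u<c) (subst (_< _) (≡.sym inner-v) 2≤c)
        }
        where
        open AddLeaf cl (up q a) (fresh q ℕₚ.≤-refl) top
        fresh′ : ∀ j → j < q → σ′ (up j a) ≡ false
        fresh′ j j<q = trans (⊕-≢ σ distinct) (fresh j (ℕₚ.m<n⇒m<1+n j<q))
          where
          distinct : up j a ≢ up q a
          -- Iterated parents have different depths as long as they are off the cycle, and `up q a`
          -- still is.
          distinct e = ℕₚ.<⇒≢ (ℕₚ.∸-monoʳ-< j<q
            (ℕₚ.<⇒≤ (ℕₚ.m∸n≢0⇒n<m λ z → ℕₚ.<⇒≢ (Closed.outside cl (fresh q ℕₚ.≤-refl)) (≡.sym (trans (δ-up q a) z)))))
            (trans (≡.sym (δ-up q a)) (trans (cong δ (≡.sym e)) (δ-up j a)))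
        open Grown (grow-tip closed′ q a (⊕-new σ (up q a)) inner-v fresh′)
        new′ : ∀ {x} → τ x ≡ true → σ x ≡ true ⊎ ∃ λ j → j < suc q × x ≡ up j a
        new′ τx with new τx
        ... | inj₂ (j , j<q , e) = inj₂ (j , ℕₚ.m<n⇒m<1+n j<q , e)
        ... | inj₁ σ′x with ⊕-elim σ σ′x
        ...   | inj₁ σx = inj₁ σx
        ...   | inj₂ e  = inj₂ (q , ℕₚ.≤-refl , e)
        x≢v : ∀ {x} → σ x ≡ true → x ≢ up q a
        x≢v σx refl = true≢false σx (fresh q ℕₚ.≤-refl)
        small′ : ∀ {c} → (∀ x → σ x ≡ true → x ≢ u → inner G σ x ≤ c) → inner G σ u < c →
          ∀ x → σ′ x ≡ true → x ≢ up q a → inner G σ′ x ≤ c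
        small′ {c} small u<c x σ′x x≢v with ⊕-elim σ σ′x
        ... | inj₂ e  = ⊥-elim (x≢v e)
        ... | inj₁ σx with x Finₚ.≟ u
        ...   | yes refl = subst (_≤ c) (≡.sym inner-u) u<c
        ...   | no x≢u   = subst (_≤ c) (≡.sym (inner-other x σx x≢u)) (small x σx x≢u)
        r : ∀ B S Q → B ℤ.+ (+ 14 ℤ.- + 4 ℤ.* S) ℤ.+ Q ≡ B ℤ.+ ((+ 10 ℤ.+ Q) ℤ.+ (+ 4 ℤ.- + 4 ℤ.* S))
        r = ℤSolver.solve-∀

      grow-tip : ∀ {σ} → Closed σ → ∀ p a → σ (up p a) ≡ true → inner G σ (up p a) ≡ 1 →
        (∀ j → j < p → σ (up j a) ≡ false) → Grown σ p a (+ (10 * p))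
      grow-tip {σ} cl zero a top one fresh = record
        { τ = σ ; closed = cl ; old = id ; new = inj₁ ; value = ≡.sym (ℤₚ.+-identityʳ _)
        ; same = λ _ _ _ → refl ; bounded = bd }
        where
        bd : ∀ {c} → 2 ≤ c → (∀ x → σ x ≡ true → x ≢ a → inner G σ x ≤ c) →
          inner G σ a < c → ∀ x → σ x ≡ true → inner G σ x ≤ c
        bd 2≤c small a<c x σx with x Finₚ.≟ a
        ... | yes refl = ℕₚ.<⇒≤ a<c
        ... | no x≢a   = small x σx x≢a
      grow-tip {σ} cl (suc q) a top one fresh = subst (Grown σ (suc q) a)
        (trans (cong (λ s → + (10 * suc q) ℤ.+ (+ 4 ℤ.- + 4 ℤ.* + s)) one) (ℤₚ.+-identityʳ _))
        (grow cl q a top fresh)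

-- Distances in the rooted structure

-- The counterpart of `lin-≤` in `ℕ`; the leftover slack `s` is made explicit because the
-- certificate is an equation.
nlin : ∀ {a b x y} s → a ≤ b → x + b + s ≡ y + a → x ≤ y
nlin {a} {b} {x} {y} s a≤b e = ℕₚ.+-cancelʳ-≤ b x y (begin
  x + b      ≤⟨ ℕₚ.m≤m+n (x + b) s ⟩
  x + b + s  ≡⟨ e ⟩
  y + a      ≤⟨ ℕₚ.+-monoʳ-≤ y a≤b ⟩
  y + b      ∎)
  where open ℕₚ.≤-Reasoning

halves : ∀ k → k ≡ ⌊ k /2⌋ + ⌊ k /2⌋ ⊎ k ≡ suc (⌊ k /2⌋ + ⌊ k /2⌋)
halves zero = inj₁ refl
halves (suc zero) = inj₂ refl
halves (suc (suc k)) with halves k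
... | inj₁ e = inj₁ (cong suc (trans (cong suc e) (≡.sym (ℕₚ.+-suc _ _))))
... | inj₂ e = inj₂ (cong (suc ∘ suc) (trans e (≡.sym (ℕₚ.+-suc _ _))))

ceil-≥ : ∀ d → d ≤ ⌈ d /2⌉ + ⌈ d /2⌉
ceil-≥ d = subst (_≤ ⌈ d /2⌉ + ⌈ d /2⌉) (ℕₚ.⌊n/2⌋+⌈n/2⌉≡n d) (ℕₚ.+-monoˡ-≤ ⌈ d /2⌉ (ℕₚ.⌊n/2⌋≤⌈n/2⌉ d))

ceil-≤ : ∀ d → ⌈ d /2⌉ + ⌈ d /2⌉ ≤ suc d
ceil-≤ zero = z≤n
ceil-≤ (suc zero) = ℕₚ.≤-refl
ceil-≤ (suc (suc d)) = s≤s (subst (_≤ suc (suc d)) (≡.sym (ℕₚ.+-suc _ _)) (s≤s (ceil-≤ d)))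

walk-along : ∀ {n q} (G : Graph n) (γ : Fin (suc q) → Fin n) → (∀ i → Adj G (γ (inject₁ i)) (γ (Fin.suc i))) →
  ∀ i j → toℕ i ≤ toℕ j → Walk G (γ i) (γ j) (toℕ j ∸ toℕ i)
walk-along G γ cons Fin.zero Fin.zero _ = here
walk-along {q = suc q} G γ cons Fin.zero (Fin.suc j) _ =
  step (cons Fin.zero) (walk-along G (γ ∘ Fin.suc) (cons ∘ Fin.suc) Fin.zero j z≤n)
walk-along {q = suc q} G γ cons (Fin.suc i) (Fin.suc j) (s≤s i≤j) =
  walk-along G (γ ∘ Fin.suc) (cons ∘ Fin.suc) i j i≤j

module Distances {n : ℕ} (G : Graph (suc n)) (conn : Connected G)
  (uniq : ∀ (C C′ : Cycle G) u v → CycleEdge C u v ⇔ CycleEdge C′ u v) (C : Cycle G) where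

  open Rooted G conn uniq C public
  open Growth G conn uniq C public

  Near : ℕ → V → V → Set
  Near = Within {G = G}

  M : ℕ
  M = ⌊ K /2⌋

  -- Sharp for K = 3 and K = 4. It pays for rounding the midpoint of a longest way.
  M+2≤K : M + 2 ≤ K
  M+2≤K = subst (_≤ K) (ℕₚ.+-comm 2 M) (s≤s (s≤s (ℕₚ.⌊n/2⌋<n (m C))))

  M+M≤K : M + M ≤ K
  M+M≤K with halves K
  ... | inj₁ e = ℕₚ.≤-reflexive (≡.sym e)
  ... | inj₂ e = subst (M + M ≤_) (≡.sym e) (ℕₚ.n≤1+n (M + M))

  K≤1+M+M : K ≤ suc (M + M)
  K≤1+M+M with halves K
  ... | inj₁ e = ℕₚ.≤-trans (ℕₚ.≤-reflexive e) (ℕₚ.n≤1+n (M + M))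
  ... | inj₂ e = ℕₚ.≤-reflexive e

  short-arc : ∀ i j → toℕ i ≤ toℕ j → Near (toℕ j ∸ toℕ i) (γ i) (γ j)
  short-arc i j i≤j = _ , ℕₚ.≤-refl , walk-along G γ (cons C) i j i≤j

  long-arc : ∀ i j → toℕ i ≤ toℕ j → Near (K ∸ (toℕ j ∸ toℕ i)) (γ j) (γ i)
  long-arc i j i≤j = _ , len , walk-++ (walk-along G γ (cons C) j (fromℕ _) (Finₚ.≤fromℕ j))
                                 (step (close C) (walk-along G γ (cons C) Fin.zero i z≤n))
    where
    regroup : ∀ a b c → a + suc c + b ≡ suc (a + (b + c))
    regroup = ℕSolver.solve-∀
    open ℕₚ.≤-Reasoning
    L = suc (suc (m C))
    len : (toℕ (fromℕ L) ∸ toℕ j) + suc (toℕ i) ≤ K ∸ (toℕ j ∸ toℕ i)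
    len = ℕₚ.m+n≤o⇒m≤o∸n _ (begin
      (toℕ (fromℕ L) ∸ toℕ j) + suc (toℕ i) + (toℕ j ∸ toℕ i)
        ≡⟨ cong (λ z → (z ∸ toℕ j) + suc (toℕ i) + (toℕ j ∸ toℕ i)) (Finₚ.toℕ-fromℕ L) ⟩
      (L ∸ toℕ j) + suc (toℕ i) + (toℕ j ∸ toℕ i)
        ≡⟨ regroup (L ∸ toℕ j) (toℕ j ∸ toℕ i) (toℕ i) ⟩
      suc ((L ∸ toℕ j) + ((toℕ j ∸ toℕ i) + toℕ i))
        ≡⟨ cong (λ z → suc ((L ∸ toℕ j) + z)) (ℕₚ.m∸n+n≡m i≤j) ⟩
      suc ((L ∸ toℕ j) + toℕ j)
        ≡⟨ cong suc (ℕₚ.m∸n+n≡m (ℕₚ.≤-pred (Finₚ.toℕ<n j))) ⟩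
      K ∎)

  arcs : ∀ i j → Near ∣ toℕ i - toℕ j ∣ (γ i) (γ j) × Near (K ∸ ∣ toℕ i - toℕ j ∣) (γ i) (γ j)
  arcs i j with ℕₚ.≤-total (toℕ i) (toℕ j)
  ... | inj₁ i≤j rewrite ℕₚ.m≤n⇒∣m-n∣≡n∸m i≤j =
    short-arc i j i≤j , within-sym {G = G} (long-arc i j i≤j)
  ... | inj₂ j≤i rewrite ℕₚ.m≤n⇒∣n-m∣≡n∸m j≤i =
    within-sym {G = G} (short-arc j i j≤i) , long-arc j i j≤i

  cycle-near : ∀ i j → Near M (γ i) (γ j)
  cycle-near i j with ℕₚ.≤-total ∣ toℕ i - toℕ j ∣ M
  ... | inj₁ d≤M = within-mono {G = G} d≤M (proj₁ (arcs i j))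
  ... | inj₂ M≤d with ℕₚ.m≤n⇒m<n∨m≡n M≤d
  ...   | inj₂ M≡d = within-mono {G = G} (ℕₚ.≤-reflexive (≡.sym M≡d)) (proj₁ (arcs i j))
  ...   | inj₁ M<d = within-mono {G = G} (ℕₚ.m≤n+o⇒m∸n≤o K ∣ toℕ i - toℕ j ∣
                       (ℕₚ.≤-trans K≤1+M+M (ℕₚ.+-monoˡ-≤ M M<d))) (proj₂ (arcs i j))

  cycle-near-< : K ≡ M + M → ∀ i j → ∣ toℕ i - toℕ j ∣ ≢ M → Near (pred M) (γ i) (γ j)
  cycle-near-< even i j d≢M with ℕₚ.<-cmp ∣ toℕ i - toℕ j ∣ M
  ... | tri< d<M _ _ = within-mono {G = G} (ℕₚ.≤-pred d<M) (proj₁ (arcs i j))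
  ... | tri≈ _ d≡M _ = ⊥-elim (d≢M d≡M)
  ... | tri> _ _ M<d = within-mono {G = G} (ℕₚ.m≤n+o⇒m∸n≤o K ∣ toℕ i - toℕ j ∣
                         (ℕₚ.≤-trans (ℕₚ.≤-reflexive (trans even (ℕₚ.+-suc M (pred M)))) (ℕₚ.+-monoˡ-≤ (pred M) M<d)))
                         (proj₂ (arcs i j))

  -- The witness is the index i ± M. By `cycle-near-<`, every cycle vertex other than `γ i` is then
  -- closer to it than M.
  antipode : K ≡ M + M → ∀ i → ∃ λ i′ → ∀ j → j ≢ i → ∣ toℕ i′ - toℕ j ∣ ≢ M
  antipode even i with toℕ i ℕ.<? M
  ... | yes i<M = fromℕ< i+M<K , λ j j≢i e → j≢i (Finₚ.toℕ-injective (other j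
          (trans (cong (∣_- toℕ j ∣) (≡.sym (Finₚ.toℕ-fromℕ< i+M<K))) e)))
    where
    i+M<K : toℕ i + M < K
    i+M<K = subst (toℕ i + M <_) (≡.sym even) (ℕₚ.+-monoˡ-< M i<M)
    other : ∀ j → ∣ toℕ i + M - toℕ j ∣ ≡ M → toℕ j ≡ toℕ i
    other j e with ℕₚ.≤-total (toℕ j) (toℕ i + M)
    ... | inj₁ j≤ = ≡.sym (ℕₚ.+-cancelʳ-≡ M (toℕ i) (toℕ j)
          (trans (≡.sym (ℕₚ.m+[n∸m]≡n j≤)) (cong (λ z → toℕ j + z) (trans (≡.sym (ℕₚ.m≤n⇒∣n-m∣≡n∸m j≤)) e))))
    ... | inj₂ ≤j = ⊥-elim (ℕₚ.<⇒≱ (Finₚ.toℕ<n j) (ℕₚ.≤-trans (ℕₚ.≤-reflexive even)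
          (ℕₚ.≤-trans (ℕₚ.≤-trans (ℕₚ.m≤n+m (M + M) (toℕ i)) (ℕₚ.≤-reflexive (≡.sym (ℕₚ.+-assoc (toℕ i) M M))))
            (ℕₚ.≤-reflexive (trans (cong (λ z → toℕ i + M + z) (trans (≡.sym e) (ℕₚ.m≤n⇒∣m-n∣≡n∸m ≤j))) (ℕₚ.m+[n∸m]≡n ≤j))))))
  ... | no i≮M = fromℕ< i-M<K , λ j j≢i e → j≢i (Finₚ.toℕ-injective (other j
          (trans (cong (∣_- toℕ j ∣) (≡.sym (Finₚ.toℕ-fromℕ< i-M<K))) e)))
    where
    i-M<K : toℕ i ∸ M < K
    i-M<K = ℕₚ.≤-<-trans (ℕₚ.m∸n≤m (toℕ i) M) (Finₚ.toℕ<n i)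
    i-M<M : toℕ i ∸ M < M
    i-M<M = ℕₚ.+-cancelʳ-< M (toℕ i ∸ M) M (subst (_< M + M) (≡.sym (ℕₚ.m∸n+n≡m (ℕₚ.≮⇒≥ i≮M)))
              (subst (toℕ i <_) even (Finₚ.toℕ<n i)))
    other : ∀ j → ∣ toℕ i ∸ M - toℕ j ∣ ≡ M → toℕ j ≡ toℕ i
    other j e with ℕₚ.≤-total (toℕ j) (toℕ i ∸ M)
    ... | inj₁ j≤ = ⊥-elim (ℕₚ.<⇒≱ i-M<M (ℕₚ.≤-trans
          (ℕₚ.≤-reflexive (trans (≡.sym e) (ℕₚ.m≤n⇒∣n-m∣≡n∸m j≤))) (ℕₚ.m∸n≤m _ (toℕ j))))
    ... | inj₂ ≤j = trans (≡.sym (ℕₚ.m+[n∸m]≡n ≤j))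
          (trans (cong (λ z → toℕ i ∸ M + z) (trans (≡.sym (ℕₚ.m≤n⇒∣m-n∣≡n∸m ≤j)) e)) (ℕₚ.m∸n+n≡m (ℕₚ.≮⇒≥ i≮M)))

  up-+ : ∀ i j v → up (i + j) v ≡ up i (up j v)
  up-+ zero    j v = refl
  up-+ (suc i) j v = cong π (up-+ i j v)

  up-near : ∀ j v → Near j v (up j v)
  up-near zero    v = within-refl {G = G}
  up-near (suc j) v = within-mono {G = G} (ℕₚ.≤-reflexive (ℕₚ.+-comm j 1))
    (within-trans {G = G} (up-near j v) one)
    where
    one : Near 1 (up j v) (π (up j v))
    one with δ (up j v) ℕ.≟ 0
    ... | yes e = subst (Near 1 (up j v)) (≡.sym (π-cycle e)) (within-refl {G = G})
    ... | no ≢0 = 1 , ℕₚ.≤-refl , step (π-adj⁺ (ℕₚ.n≢0⇒n>0 ≢0)) here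

  up-near-≤ : ∀ {i j} v → i ≤ j → Near (j ∸ i) (up i v) (up j v)
  up-near-≤ {i} {j} v i≤j = subst (Near (j ∸ i) (up i v))
    (trans (≡.sym (up-+ (j ∸ i) i v)) (cong (λ z → up z v) (ℕₚ.m∸n+n≡m i≤j))) (up-near (j ∸ i) (up i v))

  base : V → V
  base v = up (δ v) v

  δ-base : ∀ v → δ (base v) ≡ 0
  δ-base v = trans (δ-up (δ v) v) (ℕₚ.n∸n≡0 (δ v))

  base-up : ∀ {j} v → j ≤ δ v → base (up j v) ≡ base v
  base-up {j} v j≤δ = trans (cong (λ d → up d (up j v)) (δ-up j v))
    (trans (≡.sym (up-+ (δ v ∸ j) j v)) (cong (λ z → up z v) (ℕₚ.m∸n+n≡m j≤δ)))

-- The strict inequality for graphs with a vertex off the cycle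

-- This lemma and the following ones compare 20R with a budget: 10 for each cycle or chain vertex,
-- less 4 for each chain hung at inner degree 2 and 8 for one hung at inner degree 3. Here rounding
-- costs 10 and M ≤ K - 2 returns 20.
arith-stem : ∀ R D h M K → R + R ≤ suc D → D ≤ h + M → M + 2 ≤ K → suc (20 * R + 4) ≤ 10 * K + 10 * h
arith-stem R D h M K a b c = nlin 5
  (ℕₚ.+-mono-≤ (ℕₚ.*-monoʳ-≤ 10 a) (ℕₚ.+-mono-≤ (ℕₚ.*-monoʳ-≤ 10 b) (ℕₚ.*-monoʳ-≤ 10 c))) (eq R D h M K)
  where
  eq : ∀ R D h M K → suc (20 * R + 4) + (10 * suc D + (10 * (h + M) + 10 * K)) + 5
     ≡ 10 * K + 10 * h + (10 * (R + R) + (10 * D + 10 * (M + 2)))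
  eq = ℕSolver.solve-∀

arith-branch : ∀ R D h j K → R + R ≤ suc D → D ≤ h + j → 3 ≤ K → suc (20 * R + 12) ≤ 10 * K + 10 * h + 10 * j
arith-branch R D h j K a b c = nlin 7
  (ℕₚ.+-mono-≤ (ℕₚ.*-monoʳ-≤ 10 a) (ℕₚ.+-mono-≤ (ℕₚ.*-monoʳ-≤ 10 b) (ℕₚ.*-monoʳ-≤ 10 c))) (eq R D h j K)
  where
  eq : ∀ R D h j K → suc (20 * R + 12) + (10 * suc D + (10 * (h + j) + 10 * K)) + 7
     ≡ 10 * K + 10 * h + 10 * j + (10 * (R + R) + (10 * D + 10 * 3))
  eq = ℕSolver.solve-∀

arith-cycle : ∀ R D h j M K → R + R ≤ suc D → D ≤ h + M + j → M + 2 ≤ K →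
  suc (20 * R + 8) ≤ 10 * K + 10 * h + 10 * j
arith-cycle R D h j M K a b c = nlin 1
  (ℕₚ.+-mono-≤ (ℕₚ.*-monoʳ-≤ 10 a) (ℕₚ.+-mono-≤ (ℕₚ.*-monoʳ-≤ 10 b) (ℕₚ.*-monoʳ-≤ 10 c))) (eq R D h j M K)
  where
  eq : ∀ R D h j M K → suc (20 * R + 8) + (10 * suc D + (10 * (h + M + j) + 10 * K)) + 1
     ≡ 10 * K + 10 * h + 10 * j + (10 * (R + R) + (10 * D + 10 * (M + 2)))
  eq = ℕSolver.solve-∀

arith-alone : ∀ R h M K → R ≤ M → M + M ≤ K → 1 ≤ h → suc (20 * R + 4) ≤ 10 * K + 10 * h
arith-alone R h M K a b c = nlin 5
  (ℕₚ.+-mono-≤ (ℕₚ.*-monoʳ-≤ 20 a) (ℕₚ.+-mono-≤ (ℕₚ.*-monoʳ-≤ 10 b) (ℕₚ.*-monoʳ-≤ 10 c))) (eq R h M K)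
  where
  eq : ∀ R h M K → suc (20 * R + 4) + (20 * M + (10 * K + 10 * h)) + 5
     ≡ 10 * K + 10 * h + (20 * R + (10 * (M + M) + 10 * 1))
  eq = ℕSolver.solve-∀

-- The strict hypothesis is worth 10, more than the 8 lost by two chains.
arith-unequal : ∀ R h j M K → R ≤ M + j → M + M + j < K + h → suc (20 * R + 8) ≤ 10 * K + 10 * h + 10 * j
arith-unequal R h j M K a b = nlin 1
  (ℕₚ.+-mono-≤ (ℕₚ.*-monoʳ-≤ 20 a) (ℕₚ.*-monoʳ-≤ 10 b)) (eq R h j M K)
  where
  eq : ∀ R h j M K → suc (20 * R + 8) + (20 * (M + j) + 10 * (K + h)) + 1
     ≡ 10 * K + 10 * h + 10 * j + (20 * R + 10 * suc (M + M + j))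
  eq = ℕSolver.solve-∀

arith-short : ∀ R h M K → suc R ≤ M + h → M + M ≤ K → suc (20 * R + 8) ≤ 10 * K + 10 * h + 10 * h
arith-short R h M K a b = nlin 11
  (ℕₚ.+-mono-≤ (ℕₚ.*-monoʳ-≤ 20 a) (ℕₚ.*-monoʳ-≤ 10 b)) (eq R h M K)
  where
  eq : ∀ R h M K → suc (20 * R + 8) + (20 * (M + h) + 10 * K) + 11
     ≡ 10 * K + 10 * h + 10 * h + (20 * suc R + 10 * (M + M))
  eq = ℕSolver.solve-∀

-- Against 20R ≤ 20M + 20h, k chains of length h leave a surplus of 10(k - 2)h - 4k. For h = 1 this
-- is -2 with three chains and 4 with four.
arith-four : ∀ R h M K → R ≤ M + h → M + M ≤ K → 1 ≤ h →
  suc (20 * R + 16) ≤ 10 * K + 10 * h + 10 * h + 10 * h + 10 * h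
arith-four R h M K a b c = nlin 3
  (ℕₚ.+-mono-≤ (ℕₚ.*-monoʳ-≤ 20 a) (ℕₚ.+-mono-≤ (ℕₚ.*-monoʳ-≤ 10 b) (ℕₚ.*-monoʳ-≤ 20 c))) (eq R h M K)
  where
  eq : ∀ R h M K → suc (20 * R + 16) + (20 * (M + h) + (10 * K + 20 * h)) + 3
     ≡ 10 * K + 10 * h + 10 * h + 10 * h + 10 * h + (20 * R + (10 * (M + M) + 20 * 1))
  eq = ℕSolver.solve-∀

module Strict {n : ℕ} (G : Graph (suc n)) (conn : Connected G)
  (uniq : ∀ (C C′ : Cycle G) u v → CycleEdge C u v ⇔ CycleEdge C′ u v) (C : Cycle G) where

  open Distances G conn uniq C public

  abstract
    -- Opaque, so that the search defining the radius does not unfold in arithmetic goals.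
    R : ℕ
    R = radius G

    R≡radius : R ≡ radius G
    R≡radius = refl

  R≤ : ∀ {r} u → (∀ v → Near r u v) → R ≤ r
  R≤ u near = subst (_≤ _) (≡.sym R≡radius) (radius≤ G u near)

  -- Budgets are compared with natural numbers by moving all losses c to the other side.
  record Worth (σ : V → Bool) (c b : ℕ) : Set where
    constructor worth
    field
      unworth : + b ℤ.≤ budget G σ ℤ.+ + c

  worth-σ₀ : Worth σ₀ 0 (10 * K)
  worth-σ₀ = worth (ℤₚ.≤-reflexive (trans (≡.sym budget-σ₀) (≡.sym (ℤₚ.+-identityʳ _))))

  -- The chain gains 10p - 4(s - 1), where s is the inner degree of its foot; a bound s ≤ t + 1 is
  -- enough to limit the loss to 4t.
  worth-grow : ∀ {σ τ c b p s} t → Worth σ c b →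
    budget G τ ≡ budget G σ ℤ.+ (+ (10 * p) ℤ.+ (+ 4 ℤ.- + 4 ℤ.* + s)) →
    s ≤ suc t → Worth τ (c + 4 * t) (b + 10 * p)
  worth-grow {σ} {τ} {c} {b} {p} {s} t (worth w) e s≤1+t = worth (ℤ-lin-≤
    (ℤₚ.+-mono-≤ w (ℤₚ.*-monoˡ-≤-nonNeg (+ 4) (ℤ.+≤+ s≤1+t)))
    (trans (ring (+ b) (+ (10 * p)) (budget G σ) (+ c) (+ s) (+ t))
      (cong₂ (λ x y → x ℤ.+ (+ c ℤ.+ y) ℤ.+ (+ b ℤ.+ + 4 ℤ.* + s)) (≡.sym e) (≡.sym (ℤₚ.pos-* 4 t)))))
    where
    ring : ∀ b p B c s t → (b ℤ.+ p) ℤ.+ ((B ℤ.+ c) ℤ.+ + 4 ℤ.* (+ 1 ℤ.+ t))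
      ≡ (B ℤ.+ (p ℤ.+ (+ 4 ℤ.- + 4 ℤ.* s))) ℤ.+ (c ℤ.+ + 4 ℤ.* t) ℤ.+ (b ℤ.+ + 4 ℤ.* s)
    ring = ℤSolver.solve-∀

  record Claim : Set where
    constructor proven
    field
      R<harmonic : ι R ℚ.< harmonic G

  claim : ∀ {σ c b} → Closed σ → Worth σ c b → suc (20 * R + c) ≤ b → Claim
  claim {σ} {c} {b} cl (worth w) lt = proven (ℚₚ.<-≤-trans
    (subst (ℚ._< twentieths (budget G σ)) (twentieths-ι R) (twentieths-mono-< below)) (Closed.bound cl))
    where
    below : + (20 * R) ℤ.< budget G σ
    below = ℤₚ.suc[i]≤j⇒i<j (ℤ-lin-≤ {a = + suc (20 * R + c)} {b = budget G σ ℤ.+ + c}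
      (ℤₚ.≤-trans (ℤ.+≤+ lt) w) (ring (+ (20 * R)) (budget G σ) (+ c)))
      where
      ring : ∀ r B c → (+ 1 ℤ.+ r) ℤ.+ (B ℤ.+ c) ≡ B ℤ.+ (+ 1 ℤ.+ (r ℤ.+ c))
      ring = ℤSolver.solve-∀

  finish : ∀ {c b} → (∃ λ τ → Closed τ × Worth τ c b) → suc (20 * R + c) ≤ b → Claim
  finish (_ , cl , w) = claim cl w

  -- A cycle vertex that is still bare in `σ`. The condition on `base` makes every chain above it
  -- fresh at once and survives the planting of chains elsewhere.
  record Free (σ : V → Bool) (i : Fin K) : Set where
    constructor free
    field
      two   : inner G σ (γ i) ≡ 2
      empty : ∀ x → σ x ≡ true → 0 < δ x → base x ≢ γ i

  σ₀-free : ∀ i → Free σ₀ i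
  σ₀-free i = free (inner-σ₀ i) λ x σx 0<δ _ → ℕₚ.<⇒≢ 0<δ (≡.sym (σ₀-true σx))

  attach : ∀ {σ c b} → Closed σ → Worth σ c b → ∀ {i y q} → Free σ i → δ y ≡ suc q → base y ≡ γ i →
    ∃ λ τ → Closed τ × Worth τ (c + 4) (b + 10 * suc q) × (∀ j → j ≢ i → Free σ j → Free τ j)
  attach {σ} {c} {b} cl w {i} {y} {q} (free two empty) δy by = τ , closed ,
    worth-grow {τ = τ} {p = suc q} 1 w value (ℕₚ.≤-reflexive (trans (cong (inner G σ) top) two)) , free′
    where
    top : up (suc q) y ≡ γ i
    top = trans (cong (λ d → up d y) (≡.sym δy)) by
    below : ∀ {j} → j < suc q → j < δ y
    below = subst (_ <_) (≡.sym δy)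
    0<δ-up : ∀ {j} → j < suc q → 0 < δ (up j y)
    0<δ-up {j} j<p = subst (0 <_) (≡.sym (δ-up j y)) (ℕₚ.m<n⇒0<n∸m (below j<p))
    base-γ : ∀ {j} → j < suc q → base (up j y) ≡ γ i
    base-γ j<p = trans (base-up y (ℕₚ.<⇒≤ (below j<p))) by
    fresh : ∀ j → j < suc q → σ (up j y) ≡ false
    fresh j j<p with σ (up j y) in e
    ... | false = refl
    ... | true  = ⊥-elim (empty (up j y) e (0<δ-up j<p) (base-γ j<p))
    open Grown (grow cl q y (subst (λ z → σ z ≡ true) (≡.sym top) (Closed.cyc cl i)) fresh)
    free′ : ∀ j → j ≢ i → Free σ j → Free τ j
    free′ j j≢i (free two′ empty′) = free
      (trans (same (γ j) (Closed.cyc cl j) (λ e → j≢i (inj C (trans e top)))) two′) empty″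
      where
      empty″ : ∀ x → τ x ≡ true → 0 < δ x → base x ≢ γ j
      empty″ x τx 0<δ e with new τx
      ... | inj₁ σx = empty′ x σx 0<δ e
      ... | inj₂ (l , l<p , refl) = j≢i (inj C (trans (≡.sym e) (base-γ l<p)))

  module Deepest (a : V) (q : ℕ) (δa : δ a ≡ suc q) (deepest : ∀ v → δ v ≤ suc q) where

    h : ℕ
    h = suc q

    top : V
    top = up h a

    δ-top : δ top ≡ 0
    δ-top = trans (δ-up h a) (trans (cong (_∸ h) δa) (ℕₚ.n∸n≡0 h))

    σ₀-of : ∀ {v} → δ v ≡ 0 → σ₀ v ≡ true
    σ₀-of {v} = isYes-true (δ v ℕ.≟ 0)

    fresh-a : ∀ j → j < h → σ₀ (up j a) ≡ false
    fresh-a j j<h = isYes-false (δ (up j a) ℕ.≟ 0) λ e → ℕₚ.<⇒≢ (ℕₚ.m<n⇒0<n∸m j<h)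
      (≡.sym (trans (≡.sym (trans (δ-up j a) (cong (_∸ j) δa))) e))

    private
      module A = Grown (grow σ₀-closed q a (σ₀-of δ-top) fresh-a)

    σa : V → Bool
    σa = A.τ

    inner-σ₀-2 : ∀ {x} → σ₀ x ≡ true → inner G σ₀ x ≡ 2
    inner-σ₀-2 σx with on-cycle (σ₀-true σx)
    ... | i , refl = inner-σ₀ i

    worth-σa : Worth σa 4 (10 * K + 10 * h)
    worth-σa = worth-grow {τ = σa} {p = h} 1 worth-σ₀ A.value (ℕₚ.≤-reflexive (inner-σ₀-2 (σ₀-of δ-top)))

    inner-σa≤3 : ∀ x → σa x ≡ true → inner G σa x ≤ 3
    inner-σa≤3 = A.bounded (s≤s (s≤s z≤n))
      (λ x σx _ → subst (_≤ 3) (≡.sym (inner-σ₀-2 σx)) (s≤s (s≤s z≤n)))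
      (subst (_< 3) (≡.sym (inner-σ₀-2 (σ₀-of δ-top))) ℕₚ.≤-refl)

    inner-σa-cycle : ∀ i → γ i ≢ top → inner G σa (γ i) ≡ 2
    inner-σa-cycle i ≢top = trans (A.same (γ i) (Closed.cyc σ₀-closed i) ≢top) (inner-σ₀ i)

    -- The way up from y enters σa after j steps; e bounds the distance from a to the entry point.
    record Attachment (y : V) : Set where
      field
        j e   : ℕ
        stem  : σa (up j y) ≡ true
        fresh : ∀ l → l < j → σa (up l y) ≡ false
        kind  : (e ≤ h × up j y ≡ up e a × j ≤ e)
              ⊎ (∃ λ i → e ≡ h + M × γ i ≡ up j y × γ i ≢ top × δ y ≡ j)

    abstract
      -- In the first kind, `j ≤ e` because `y` and `a` lie j and e steps below the same vertex and
      -- `a` is deepest; entry at `top` belongs here, with e = h. In the second kind the summand M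
      -- pays for the way around the cycle from `top`.
      attachment : ∀ y → Attachment y
      attachment y with least (λ j → σa (up j y) Data.Bool.≟ true) (δ y) (A.old (σ₀-of (δ-base y)))
      ... | j , stem , first-j = go (A.new stem)
        where
        fresh : ∀ l → l < j → σa (up l y) ≡ false
        fresh l l<j with σa (up l y) in eq
        ... | false = refl
        ... | true  = ⊥-elim (first-j l l<j eq)
        j≤δ : j ≤ δ y
        j≤δ = ℕₚ.≮⇒≥ λ δ<j → first-j (δ y) δ<j (A.old (σ₀-of (δ-base y)))
        go : σ₀ (up j y) ≡ true ⊎ (∃ λ i → i < h × up j y ≡ up i a) → Attachment y
        go (inj₂ (i , i<h , eq)) = record
          { j = j ; e = i ; stem = stem ; fresh = fresh ; kind = inj₁ (ℕₚ.<⇒≤ i<h , eq , j≤i) }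
          where
          open ℕₚ.≤-Reasoning
          j≤i : j ≤ i
          j≤i = begin
            j                    ≡⟨ ℕₚ.m∸[m∸n]≡n j≤δ ⟨
            δ y ∸ (δ y ∸ j)      ≡⟨ cong (δ y ∸_) (trans (≡.sym (δ-up j y)) (trans (cong δ eq) (trans (δ-up i a) (cong (_∸ i) δa)))) ⟩
            δ y ∸ (h ∸ i)        ≤⟨ ℕₚ.∸-monoˡ-≤ (h ∸ i) (deepest y) ⟩
            h ∸ (h ∸ i)          ≡⟨ ℕₚ.m∸[m∸n]≡n (ℕₚ.<⇒≤ i<h) ⟩
            i                    ∎
        go (inj₁ σx) with up j y Finₚ.≟ top
        ... | yes eq = record { j = j ; e = h ; stem = stem ; fresh = fresh
                              ; kind = inj₁ (ℕₚ.≤-refl , eq , ℕₚ.≤-trans j≤δ (deepest y)) }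
        ... | no ≢top = record { j = j ; e = h + M ; stem = stem ; fresh = fresh
                               ; kind = inj₂ (proj₁ on , refl , proj₂ on , (λ eq → ≢top (trans (≡.sym (proj₂ on)) eq)) ,
                                   ℕₚ.≤-antisym (ℕₚ.m∸n≡0⇒m≤n (trans (≡.sym (δ-up j y)) (σ₀-true σx))) j≤δ) }
          where
          on : ∃ λ i → γ i ≡ up j y
          on = on-cycle (σ₀-true σx)

    open Attachment

    -- An upper bound for the distance from `a` to `y`. The vertex `z` below maximises this bound
    -- instead of the distance, which spares exact distances.
    reachOf : V → ℕ
    reachOf y = e (attachment y) + j (attachment y)

    regrow : ∀ y q′ → j (attachment y) ≡ suc q′ → ∀ t → inner G σa (up (suc q′) y) ≤ suc t →
      ∃ λ τ → Closed τ × Worth τ (4 + 4 * t) (10 * K + 10 * h + 10 * suc q′)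
    regrow y q′ eq t small = τ , closed , worth-grow {τ = τ} {p = suc q′} t worth-σa value small
      where
      open Grown (grow A.closed q′ y (subst (λ z → σa (up z y) ≡ true) eq (stem (attachment y)))
        (λ l l<j → fresh (attachment y) l (subst (l <_) (≡.sym eq) l<j)))

    top-near : ∀ i → Near M top (γ i)
    top-near i = subst (λ z → Near M z (γ i)) (proj₂ (on-cycle δ-top)) (cycle-near _ i)

    stem-near : ∀ y {w} → up (j (attachment y)) y ≡ w → Near (j (attachment y)) w y
    stem-near y refl = within-sym {G = G} (up-near (j (attachment y)) y)

    module Farthest (z : V) (farthest : ∀ y → reachOf y ≤ reachOf z) where

      D : ℕ
      D = reachOf z

      jz : ℕ
      jz = j (attachment z)

      module Balanced (D≤2h : D ≤ h + h) where

        -- Halfway from `a` to `z`, rounded up. D ≤ 2h keeps the centre `up c a` on the chain of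
        -- `a`.
        c : ℕ
        c = ⌈ D /2⌉

        D≤2c : D ≤ c + c
        D≤2c = ceil-≥ D

        c≤h : c ≤ h
        c≤h = subst (c ≤_) (≡.sym (ℕₚ.n≡⌈n+n/2⌉ h)) (ℕₚ.⌈n/2⌉-mono D≤2h)

        -- A vertex entering at or beyond the centre is within D - c ≤ c of it. One entering before
        -- the centre is, by j ≤ e, covered by the same bound as `a` itself.
        near : ∀ y → Near c (up c a) y
        near y with farthest y | kind (attachment y)
        ... | far | inj₁ (e≤h , stem≡ , j≤e) with ℕₚ.≤-total c (e (attachment y))
        ...   | inj₁ c≤e = within-mono {G = G}
                  (ℕₚ.+-cancelˡ-≤ c _ _ (ℕₚ.≤-trans (ℕₚ.≤-reflexive (trans (≡.sym (ℕₚ.+-assoc c _ _))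
                     (cong (_+ j (attachment y)) (ℕₚ.m+[n∸m]≡n c≤e)))) (ℕₚ.≤-trans far D≤2c)))
                  (within-trans {G = G} (up-near-≤ a c≤e)
                    (stem-near y stem≡))
        ...   | inj₂ e≤c = within-mono {G = G}
                  (ℕₚ.≤-trans (ℕₚ.+-monoʳ-≤ (c ∸ e (attachment y)) j≤e) (ℕₚ.≤-reflexive (ℕₚ.m∸n+n≡m e≤c)))
                  (within-trans {G = G} (within-sym {G = G} (up-near-≤ a e≤c))
                    (stem-near y stem≡))
        near y | far | inj₂ (i , e≡ , γ≡ , _ , _) = within-mono {G = G}
                  (ℕₚ.+-cancelˡ-≤ c _ _ (ℕₚ.≤-trans (ℕₚ.≤-reflexive (trans (regroup c (h ∸ c) M jy)
                     (trans (cong (λ x → x + M + jy) (ℕₚ.m+[n∸m]≡n c≤h)) (cong (_+ jy) (≡.sym e≡)))))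
                     (ℕₚ.≤-trans far D≤2c)))
                  (within-trans {G = G} (up-near-≤ a c≤h) (within-trans {G = G} (top-near i)
                    (stem-near y (≡.sym γ≡))))
          where
          jy = j (attachment y)
          regroup : ∀ c x M j → c + (x + (M + j)) ≡ c + x + M + j
          regroup = ℕSolver.solve-∀

        2R≤1+D : R + R ≤ suc D
        2R≤1+D = ℕₚ.≤-trans (ℕₚ.+-mono-≤ R≤c R≤c) (ceil-≤ D)
          where
          R≤c : R ≤ c
          R≤c = R≤ (up c a) near

        result : Claim
        result = go jz refl (kind (attachment z))
          where
          ez : ℕ
          ez = e (attachment z)
          go : ∀ j → jz ≡ j → (ez ≤ h × up jz z ≡ up ez a × jz ≤ ez)
             ⊎ (∃ λ i → ez ≡ h + M × γ i ≡ up jz z × γ i ≢ top × δ z ≡ jz) → Claim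
          go zero jz≡ k = claim A.closed worth-σa (arith-stem R D h M K 2R≤1+D D≤ M+2≤K)
            where
            ez≤ : (ez ≤ h × up jz z ≡ up ez a × jz ≤ ez)
             ⊎ (∃ λ i → ez ≡ h + M × γ i ≡ up jz z × γ i ≢ top × δ z ≡ jz) → ez ≤ h + M
            ez≤ (inj₁ (ez≤h , _))  = ℕₚ.≤-trans ez≤h (ℕₚ.m≤m+n h M)
            ez≤ (inj₂ (_ , ez≡ , _)) = ℕₚ.≤-reflexive ez≡
            D≤ : D ≤ h + M
            D≤ = subst (_≤ h + M) (trans (≡.sym (ℕₚ.+-identityʳ ez)) (cong (λ x → ez + x) (≡.sym jz≡))) (ez≤ k)
          -- The second chain hangs on the first or at `top`, where the inner degree is at most 3;
          -- hence the 2.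
          go (suc q′) jz≡ (inj₁ (ez≤h , _)) = finish (regrow z q′ jz≡ 2
            (inner-σa≤3 _ (subst (λ x → σa (up x z) ≡ true) jz≡ (stem (attachment z)))))
            (arith-branch R D h (suc q′) K 2R≤1+D D≤ (s≤s (s≤s (s≤s z≤n))))
            where
            D≤ : D ≤ h + suc q′
            D≤ = ℕₚ.+-mono-≤ ez≤h (ℕₚ.≤-reflexive jz≡)
          go (suc q′) jz≡ (inj₂ (i , ez≡ , γ≡ , γ≢top , _)) = finish (regrow z q′ jz≡ 1
            (ℕₚ.≤-reflexive (trans (cong (inner G σa) (trans (cong (λ x → up x z) (≡.sym jz≡)) (≡.sym γ≡))) (inner-σa-cycle i γ≢top))))
            (arith-cycle R D h (suc q′) M K 2R≤1+D D≤ M+2≤K)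
            where
            D≤ : D ≤ h + M + suc q′
            D≤ = ℕₚ.+-mono-≤ (ℕₚ.≤-reflexive ez≡) (ℕₚ.≤-reflexive jz≡)

      module Wide (h+h<D : h + h < D) where

        ez : ℕ
        ez = e (attachment z)

        -- Entry on the chain of `a` would give D ≤ h + h, since j ≤ e ≤ h there.
        z-off : ∃ λ i → ez ≡ h + M × γ i ≡ up jz z × γ i ≢ top × δ z ≡ jz
        z-off with kind (attachment z)
        ... | inj₂ k = k
        ... | inj₁ (ez≤h , _ , jz≤ez) =
          ⊥-elim (ℕₚ.<⇒≱ h+h<D (ℕₚ.+-mono-≤ ez≤h (ℕₚ.≤-trans jz≤ez ez≤h)))

        D≡ : D ≡ h + M + jz
        D≡ = cong (_+ jz) (proj₁ (proj₂ z-off))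

        h≤M+jz : h ≤ M + jz
        h≤M+jz = ℕₚ.<⇒≤ (ℕₚ.+-cancelˡ-< h h (M + jz) (subst (h + h <_) (trans D≡ (ℕₚ.+-assoc h M jz)) h+h<D))

        -- Across the cycle, the maximality of `z` reduces to a comparison of chain lengths after
        -- cancelling h + M. On the side of `a` the distance is at most h, and D > 2h forces h ≤ M +
        -- `jz`.
        near-top : ∀ y → Near (M + jz) top y
        near-top y with farthest y | kind (attachment y)
        ... | far | inj₁ (e≤h , stem≡ , j≤e) = within-mono {G = G}
                (ℕₚ.≤-trans (ℕₚ.+-monoʳ-≤ (h ∸ e (attachment y)) j≤e)
                  (ℕₚ.≤-trans (ℕₚ.≤-reflexive (ℕₚ.m∸n+n≡m e≤h)) h≤M+jz))
                (within-trans {G = G} (within-sym {G = G} (up-near-≤ a e≤h))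
                  (stem-near y stem≡))
        ... | far | inj₂ (i , e≡ , γ≡ , _ , _) = within-mono {G = G}
                (ℕₚ.+-cancelˡ-≤ h _ _ (ℕₚ.≤-trans (ℕₚ.≤-reflexive (trans (≡.sym (ℕₚ.+-assoc h M _)) (cong (_+ j (attachment y)) (≡.sym e≡))))
                  (ℕₚ.≤-trans far (ℕₚ.≤-reflexive (trans D≡ (ℕₚ.+-assoc h M jz))))))
                (within-trans {G = G} (top-near i)
                  (stem-near y (≡.sym γ≡)))

        R≤M+jz : R ≤ M + jz
        R≤M+jz = R≤ top near-top

        jz≤h : jz ≤ h
        jz≤h = subst (_≤ h) (proj₂ (proj₂ (proj₂ (proj₂ z-off)))) (deepest z)

        two-chains : ∀ q′ → jz ≡ suc q′ → ∃ λ τ → Closed τ × Worth τ 8 (10 * K + 10 * h + 10 * jz)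
        two-chains q′ jz≡ with z-off
        ... | i , _ , γ≡ , γ≢top , _ = subst (λ x → ∃ λ τ → Closed τ × Worth τ 8 (10 * K + 10 * h + 10 * x)) (≡.sym jz≡)
          (regrow z q′ jz≡ 1 (ℕₚ.≤-reflexive (trans (cong (inner G σa) (trans (cong (λ x → up x z) (≡.sym jz≡)) (≡.sym γ≡))) (inner-σa-cycle i γ≢top))))

        Tall : Fin K → Set
        Tall i = ∃ λ y → δ y ≡ h × base y ≡ γ i

        tall? : ∀ i → Dec (Tall i)
        tall? i = Finₚ.any? λ y → (δ y ℕ.≟ h) ×-dec (base y Finₚ.≟ γ i)

        module FourChains (tall : ∀ i → Tall i) (R≤M+h : R ≤ M + h) (index : Fin 4 → Fin K)
          (index-inj : ∀ l l′ → index l ≡ index l′ → l ≡ l′) where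

          Planted : (V → Bool) → ℕ → ℕ → Fin K → Set
          Planted σ c b i = ∃ λ τ → Closed τ × Worth τ c b × (∀ j → j ≢ i → Free σ j → Free τ j)

          plant : ∀ {σ c b} → Closed σ → Worth σ c b → ∀ i → Free σ i → Planted σ (c + 4) (b + 10 * h) i
          plant cl w i f = attach cl w f (proj₁ (proj₂ (tall i))) (proj₂ (proj₂ (tall i)))

          i₀ i₁ i₂ i₃ : Fin K
          i₀ = index (Fin.# 0)
          i₁ = index (Fin.# 1)
          i₂ = index (Fin.# 2)
          i₃ = index (Fin.# 3)

          1≢0 : i₁ ≢ i₀
          1≢0 e = case index-inj _ _ e of λ ()
          2≢0 : i₂ ≢ i₀
          2≢0 e = case index-inj _ _ e of λ ()
          3≢0 : i₃ ≢ i₀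
          3≢0 e = case index-inj _ _ e of λ ()
          2≢1 : i₂ ≢ i₁
          2≢1 e = case index-inj _ _ e of λ ()
          3≢1 : i₃ ≢ i₁
          3≢1 e = case index-inj _ _ e of λ ()
          3≢2 : i₃ ≢ i₂
          3≢2 e = case index-inj _ _ e of λ ()

          last : ∀ {σ c b} → Free σ i₃ → Planted σ c b i₂ →
            suc (20 * R + (c + 4)) ≤ b + 10 * h → Claim
          last free₃ (_ , cl , w , f) lt = finish′ (plant cl w i₃ (f i₃ 3≢2 free₃)) lt
            where
            finish′ : ∀ {σ c b i} → Planted σ c b i → suc (20 * R + c) ≤ b → Claim
            finish′ (_ , cl , w , _) = claim cl w

          result : Claim
          result = go₁ (plant σ₀-closed worth-σ₀ i₀ (σ₀-free i₀))
            where
            go₂ : ∀ {σ} → Free σ i₂ → Free σ i₃ → Planted σ 8 (10 * K + 10 * h + 10 * h) i₁ → Claim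
            go₂ free₂ free₃ (_ , cl , w , f) = last (f i₃ 3≢1 free₃) (plant cl w i₂ (f i₂ 2≢1 free₂))
              (arith-four R h M K R≤M+h M+M≤K (s≤s z≤n))
            go₁ : Planted σ₀ 4 (10 * K + 10 * h) i₀ → Claim
            go₁ (_ , cl , w , f) = go₂ (f i₂ 2≢0 (σ₀-free i₂)) (f i₃ 3≢0 (σ₀-free i₃))
              (plant cl w i₁ (f i₁ 1≢0 (σ₀-free i₁)))

        -- An even cycle has at least four vertices, which gives the four chains distinct feet.
        all-tall : K ≡ M + M → R ≤ M + h → (∀ i → Tall i) → Claim
        all-tall even R≤M+h tall = FourChains.result tall R≤M+h
          (λ l → Fin.inject≤ l 4≤K) (Finₚ.inject≤-injective 4≤K 4≤K)
          where
          2≤M : 2 ≤ M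
          2≤M = ℕₚ.+-cancelˡ-≤ M 2 M (ℕₚ.≤-trans M+2≤K (ℕₚ.≤-reflexive even))
          4≤K : 4 ≤ K
          4≤K = subst (4 ≤_) (≡.sym even) (ℕₚ.+-mono-≤ 2≤M 2≤M)

        -- If no deepest vertex sits above γ i, the antipode of γ i is within M + h - 1 of everything.
        some-short : K ≡ M + M → ∀ i → ¬ Tall i → suc R ≤ M + h
        some-short even i short with antipode even i
        ... | i′ , unique = subst (suc R ≤_) (≡.sym (ℕₚ.+-suc M q)) (s≤s (R≤ (γ i′) near))
          where
          near : ∀ y → Near (M + q) (γ i′) y
          near y with on-cycle (δ-base y)
          ... | k , γk with k Finₚ.≟ i
          ...   | yes refl = within-mono {G = G}
                    (ℕₚ.+-monoʳ-≤ M (ℕₚ.≤-pred (ℕₚ.≤∧≢⇒< (deepest y) λ δy → short (y , δy , ≡.sym γk))))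
                    (within-trans {G = G} (cycle-near i′ k) (subst (λ w → Near (δ y) w y) (≡.sym γk) (within-sym {G = G} (up-near (δ y) y))))
          ...   | no k≢i   = within-mono {G = G}
                    (ℕₚ.≤-trans (ℕₚ.+-monoʳ-≤ (pred M) (deepest y)) (ℕₚ.≤-reflexive (ℕₚ.+-suc (pred M) q)))
                    (within-trans {G = G} (cycle-near-< even i′ k (unique k k≢i)) (subst (λ w → Near (δ y) w y) (≡.sym γk) (within-sym {G = G} (up-near (δ y) y))))

        equal : K ≡ M + M → ∀ q′ → jz ≡ suc q′ → jz ≡ h → Claim
        equal even q′ jz≡ jz≡h with Finₚ.all? tall?
        ... | yes tall = all-tall even (subst (λ x → R ≤ M + x) jz≡h R≤M+jz) tall
        ... | no ¬tall with Finₚ.¬∀⟶∃¬ K Tall tall? ¬tall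
        ...   | i , short = finish (two-chains q′ jz≡)
                (subst (λ x → suc (20 * R + 8) ≤ 10 * K + 10 * h + 10 * x) (≡.sym jz≡h)
                  (arith-short R h M K (some-short even i short) M+M≤K))

        unequal : ∀ q′ → jz ≡ suc q′ → M + M + jz < K + h → Claim
        unequal q′ jz≡ lt = finish (two-chains q′ jz≡) (arith-unequal R h jz M K R≤M+jz lt)

        result : Claim
        result = go jz refl
          where
          go : ∀ j → jz ≡ j → Claim
          go zero jz≡ = claim A.closed worth-σa
            (arith-alone R h M K (ℕₚ.≤-trans R≤M+jz (ℕₚ.≤-reflexive (trans (cong (λ x → M + x) jz≡) (ℕₚ.+-identityʳ M)))) M+M≤K (s≤s z≤n))
          go (suc q′) jz≡ with halves K
          -- The extra vertex of an odd cycle supplies the strict inequality; on an even cycle it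
          -- has to come from `jz` < h.
          ... | inj₂ odd = unequal q′ jz≡ (ℕₚ.+-mono-≤ (ℕₚ.≤-reflexive (≡.sym odd)) jz≤h)
          ... | inj₁ even with ℕₚ.m≤n⇒m<n∨m≡n jz≤h
          ...   | inj₂ jz≡h = equal even q′ jz≡ jz≡h
          ...   | inj₁ jz<h = unequal q′ jz≡ (ℕₚ.≤-trans (ℕₚ.≤-reflexive (≡.sym (ℕₚ.+-suc (M + M) jz))) (ℕₚ.+-mono-≤ (ℕₚ.≤-reflexive (≡.sym even)) jz<h))

      result : Claim
      result with D ℕ.≤? h + h
      ... | yes D≤2h = Balanced.result D≤2h
      ... | no D≰2h  = Wide.result (ℕₚ.≰⇒> D≰2h)

    result : Claim
    result = Farthest.result (proj₁ (argmax reachOf)) (proj₂ (argmax reachOf))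

  strict : ∀ v → 0 < δ v → Claim
  strict v 0<δ with argmax δ
  ... | a , max = go (δ a) refl
    where
    go : ∀ d → δ a ≡ d → Claim
    go zero    δa = ⊥-elim (ℕₚ.<⇒≱ 0<δ (subst (δ v ≤_) δa (max v)))
    go (suc q) δa = Deepest.result a q δa (λ w → subst (δ w ≤_) δa (max w))

-- Cycle graphs

-- `IsCycleGraph` wants a bijection of `Fin N` with itself. Stating k = N between variables allows
-- it to be matched with `refl`.
cycleGraph-intro : ∀ {N k} (G : Graph N) (γ : Fin k → Fin N) → k ≡ N → 3 ≤ k → Injective _≡_ _≡_ γ →
  (∀ v → ∃ λ i → γ i ≡ v) → (∀ i j → Adj G (γ i) (γ j) ⇔ CnAdj i j) → IsCycleGraph G
cycleGraph-intro G γ refl 3≤k γ-inj surj adj⇔ =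
  3≤k , mk↔ₛ′ γ (proj₁ ∘ surj) (proj₂ ∘ surj) (λ i → γ-inj (proj₂ (surj (γ i)))) , adj⇔

module CycleCase {n : ℕ} (G : Graph (suc n)) (conn : Connected G)
  (uniq : ∀ (C C′ : Cycle G) u v → CycleEdge C u v ⇔ CycleEdge C′ u v) (C : Cycle G) where

  open Strict G conn uniq C public

  module _ (flat : ∀ v → δ v ≡ 0) where

    K≡1+n : K ≡ suc n
    K≡1+n = trans (≡.sym cnt-σ₀)
      (cnt-image σ₀ id id (λ v → isYes-true (δ v ℕ.≟ 0) (flat v)) (λ v _ → v , refl))

    R≤M : R ≤ M
    R≤M = R≤ (γ Fin.zero) near
      where
      near : ∀ v → Near M (γ Fin.zero) v
      near v with on-cycle (flat v)
      ... | i , refl = cycle-near Fin.zero i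

    cycle-bound : ι R ℚ.≤ harmonic G
    cycle-bound = ℚₚ.≤-trans (ℚₚ.≤-reflexive (≡.sym (twentieths-ι R)))
      (ℚₚ.≤-trans (twentieths-mono-≤ below) (Closed.bound σ₀-closed))
      where
      eq : ∀ R M K → 20 * R + (20 * M + 10 * K) + 0 ≡ 10 * K + (20 * R + 10 * (M + M))
      eq = ℕSolver.solve-∀
      below : + (20 * R) ℤ.≤ budget G σ₀
      below = ℤₚ.≤-trans
        (ℤ.+≤+ (nlin 0 (ℕₚ.+-mono-≤ (ℕₚ.*-monoʳ-≤ 20 R≤M) (ℕₚ.*-monoʳ-≤ 10 M+M≤K)) (eq R M K)))
        (ℤₚ.≤-reflexive (≡.sym budget-σ₀))

    odd-strict : K ≡ suc (M + M) → Claim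
    odd-strict odd = claim σ₀-closed worth-σ₀
      (nlin 9 (ℕₚ.+-mono-≤ (ℕₚ.*-monoʳ-≤ 20 R≤M) (ℕₚ.*-monoʳ-≤ 10 (ℕₚ.≤-reflexive (≡.sym odd)))) (eq R M K))
      where
      eq : ∀ R M K → suc (20 * R + 0) + (20 * M + 10 * K) + 9 ≡ 10 * K + (20 * R + 10 * suc (M + M))
      eq = ℕSolver.solve-∀

    isCycleGraph : IsCycleGraph G
    isCycleGraph = cycleGraph-intro G γ K≡1+n (s≤s (s≤s (s≤s z≤n))) (inj C) (on-cycle ∘ flat)
      (λ i j → mk⇔ (λ e → cycleEdge-index i j (chord (δ-γ i) (δ-γ j) e)) (index-adj i j))

    deg-two : ∀ v → deg G v ≡ 2
    deg-two v with on-cycle (flat v)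
    ... | i , refl = trans (cnt-cong (λ j → ≡.sym (trans
      (cong (adj G (γ i) j ∧_) (isYes-true (δ j ℕ.≟ 0) (flat j))) (∧-identityʳ (adj G (γ i) j))))) (inner-σ₀ i)

    harmonic≤ : harmonic G ℚ.≤ twentieths (+ (10 * K))
    harmonic≤ = begin
      harmonic G                                         ≤⟨ harmonic≤arcSum G (λ _ _ → ¼) (λ i j _ → half i j) ⟩
      arcSum G (λ _ _ → ¼)                               ≡⟨ ℚΣ.sum-cong-≗ row ⟩
      ℚΣ.sum (λ i → twentieths (if σ₀ i then + 10 else ℤ.0ℤ)) ≡⟨ twentieths-sum (λ i → if σ₀ i then + 10 else ℤ.0ℤ) ⟨
      twentieths (ℤΣ.sum (λ i → if σ₀ i then + 10 else ℤ.0ℤ)) ≡⟨ cong twentieths (ℤ-sum-if σ₀ 10) ⟩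
      twentieths (+ (10 * cnt σ₀))                       ≡⟨ cong (λ k → twentieths (+ (10 * k))) cnt-σ₀ ⟩
      twentieths (+ (10 * K))                            ∎
      where
      open ℚₚ.≤-Reasoning
      ¼ : ℚ
      -- Every edge joins two vertices of degree 2, so its value 2/4 splits into two quarters.
      ¼ = twentieths (+ 5)
      half : ∀ i j → twoOver (deg G i + deg G j) ℚ.≤ ¼ ℚ.+ ¼
      half i j = ℚₚ.≤-reflexive (cong₂ (λ a b → twoOver (a + b)) (deg-two i) (deg-two j))
      row : ∀ i → ℚΣ.sum (λ j → when (adj G i j) ¼) ≡ twentieths (if σ₀ i then + 10 else ℤ.0ℤ)
      row i = trans (sum-when (adj G i) ¼) (trans (cong (λ d → ι d ℚ.* ¼) (deg-two i))
        (cong twentieths (≡.sym (if-true (isYes-true (δ i ℕ.≟ 0) (flat i))))))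

  dichotomy : (∃ λ v → 0 < δ v) ⊎ (∀ v → δ v ≡ 0)
  dichotomy with Finₚ.any? (λ v → 0 ℕ.<? δ v)
  ... | yes p = inj₁ p
  ... | no ¬p = inj₂ λ v → ℕₚ.n≤0⇒n≡0 (ℕₚ.≮⇒≥ λ 0<δ → ¬p (v , 0<δ))

  lower-bound : ι R ℚ.≤ harmonic G
  lower-bound with dichotomy
  ... | inj₁ (v , 0<δ) = ℚₚ.<⇒≤ (Claim.R<harmonic (strict v 0<δ))
  ... | inj₂ flat = cycle-bound flat

  -- A vertex off the cycle and an odd cycle each force strict inequality, which leaves the even
  -- cycle.
  equality⇒ : harmonic G ≡ ι R → IsCycleGraph G × 2 ∣ suc n
  equality⇒ eq with dichotomy
  ... | inj₁ (v , 0<δ) = ⊥-elim (ℚₚ.<-irrefl (≡.sym eq) (Claim.R<harmonic (strict v 0<δ)))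
  ... | inj₂ flat with halves K
  ...   | inj₂ odd  = ⊥-elim (ℚₚ.<-irrefl (≡.sym eq) (Claim.R<harmonic (odd-strict flat odd)))
  ...   | inj₁ even = isCycleGraph flat , divides M (trans (≡.sym (K≡1+n flat)) (trans even (double M)))
    where
    double : ∀ M → M + M ≡ M * 2
    double = ℕSolver.solve-∀

-- The cyclic distance is a 1-Lipschitz function on the cycle, so it bounds distances from below.
module _ (N : ℕ) where

  cyc : ℕ → ℕ → ℕ
  cyc a x = ∣ a - x ∣ ℕ.⊓ (N ∸ ∣ a - x ∣)

  lipschitz : ∀ {d d′} → d′ ≤ suc d → d ≤ suc d′ → d′ ℕ.⊓ (N ∸ d′) ≤ suc (d ℕ.⊓ (N ∸ d))
  lipschitz {d} {d′} p q = ℕₚ.⊓-mono-≤ p (ℕₚ.m≤n+o⇒m∸n≤o N d′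
    (ℕₚ.≤-trans (ℕₚ.m≤n+m∸n N d) (ℕₚ.≤-trans (ℕₚ.+-monoˡ-≤ (N ∸ d) q) (ℕₚ.≤-reflexive (≡.sym (ℕₚ.+-suc d′ (N ∸ d)))))))

  -- For the step between the indices N - 1 and 0. Since N - d = d′ + 1 and N - d′ = d + 1, the
  -- entries of the two minima bound each other crosswise.
  lipschitz-wrap : ∀ {d d′} → suc (d + d′) ≡ N → d′ ℕ.⊓ (N ∸ d′) ≤ suc (d ℕ.⊓ (N ∸ d))
  lipschitz-wrap {d} {d′} refl = ℕₚ.⊓-glb
    (ℕₚ.≤-trans (ℕₚ.m⊓n≤n d′ _) (ℕₚ.≤-reflexive (ℕₚ.m+n∸n≡m (suc d) d′)))
    (ℕₚ.≤-trans (ℕₚ.m⊓n≤m d′ _) (ℕₚ.≤-trans (ℕₚ.m≤n+m d′ 2)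
      (ℕₚ.≤-reflexive (cong suc (≡.sym (trans (cong (_∸ d) (≡.sym (ℕₚ.+-suc d d′))) (ℕₚ.m+n∸m≡n d (suc d′))))))))

∣a-1+x∣≤ : ∀ a x → ∣ a - suc x ∣ ≤ suc ∣ a - x ∣
∣a-1+x∣≤ a x = ℕₚ.≤-trans (ℕₚ.∣-∣-triangle a x (suc x))
  (ℕₚ.≤-reflexive (trans (cong (λ z → ∣ a - x ∣ + z) (trans (ℕₚ.m≤n⇒∣m-n∣≡n∸m (ℕₚ.n≤1+n x)) (ℕₚ.m+n∸n≡m 1 x))) (ℕₚ.+-comm _ 1)))

∣a-x∣≤ : ∀ a x → ∣ a - x ∣ ≤ suc ∣ a - suc x ∣
∣a-x∣≤ a x = ℕₚ.≤-trans (ℕₚ.∣-∣-triangle a (suc x) x)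
  (ℕₚ.≤-reflexive (trans (cong (λ z → ∣ a - suc x ∣ + z) (trans (ℕₚ.m≤n⇒∣n-m∣≡n∸m (ℕₚ.n≤1+n x)) (ℕₚ.m+n∸n≡m 1 x))) (ℕₚ.+-comm _ 1)))

cyc-step : ∀ {N} (a i j : Fin N) → CnAdj i j → cyc N (toℕ a) (toℕ j) ≤ suc (cyc N (toℕ a) (toℕ i))
cyc-step {N} a i j (inj₁ e) rewrite ≡.sym e = lipschitz N (∣a-1+x∣≤ (toℕ a) (toℕ i)) (∣a-x∣≤ (toℕ a) (toℕ i))
cyc-step {N} a i j (inj₂ (inj₁ e)) rewrite ≡.sym e = lipschitz N (∣a-x∣≤ (toℕ a) (toℕ j)) (∣a-1+x∣≤ (toℕ a) (toℕ j))
cyc-step {suc N} a i j (inj₂ (inj₂ (inj₁ (e , j≡0)))) rewrite j≡0 | ℕₚ.suc-injective e | ℕₚ.∣-∣-identityʳ (toℕ a)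
  | ℕₚ.m≤n⇒∣m-n∣≡n∸m (ℕₚ.≤-pred (Finₚ.toℕ<n a)) =
  lipschitz-wrap (suc N) (cong suc (ℕₚ.m∸n+n≡m (ℕₚ.≤-pred (Finₚ.toℕ<n a))))
cyc-step {suc N} a i j (inj₂ (inj₂ (inj₂ (e , i≡0)))) rewrite i≡0 | ℕₚ.suc-injective e | ℕₚ.∣-∣-identityʳ (toℕ a)
  | ℕₚ.m≤n⇒∣m-n∣≡n∸m (ℕₚ.≤-pred (Finₚ.toℕ<n a)) =
  lipschitz-wrap (suc N) (cong suc (ℕₚ.m+[n∸m]≡n (ℕₚ.≤-pred (Finₚ.toℕ<n a))))

⊓-half : ∀ {d t} → d ≡ t → d ℕ.⊓ (t + t ∸ d) ≡ t
⊓-half {t = t} refl = trans (cong (t ℕ.⊓_) (ℕₚ.m+n∸n≡m t t)) (ℕₚ.⊓-idem t)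

opposite : ∀ {N t} → N ≡ t + t → (a : Fin N) → ∃ λ (b : Fin N) → cyc N (toℕ a) (toℕ b) ≡ t
opposite {N} {t} refl a with toℕ a ℕ.<? t
... | yes a<t = fromℕ< a+t<N , trans (cong (cyc N (toℕ a)) (Finₚ.toℕ-fromℕ< a+t<N)) (⊓-half (ℕₚ.∣m-m+n∣≡n (toℕ a) t))
  where
  a+t<N : toℕ a + t < N
  a+t<N = ℕₚ.+-monoˡ-< t a<t
... | no a≮t = fromℕ< a-t<N , trans (cong (cyc N (toℕ a)) (Finₚ.toℕ-fromℕ< a-t<N))
    (⊓-half (trans (ℕₚ.m≤n⇒∣n-m∣≡n∸m (ℕₚ.m∸n≤m (toℕ a) t)) (ℕₚ.m∸[m∸n]≡n (ℕₚ.≮⇒≥ a≮t))))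
  where
  a-t<N : toℕ a ∸ t < N
  a-t<N = ℕₚ.≤-<-trans (ℕₚ.m∸n≤m (toℕ a) t) (Finₚ.toℕ<n a)

-- The cyclic distance from `u` serves as the potential in `φ≤dist`; at the vertex opposite to `u`
-- its value is t.
cycleGraph-radius : ∀ {n t} (G : Graph (suc n)) → IsCycleGraph G → suc n ≡ t + t → t ≤ radius G
cycleGraph-radius {n} {t} G (_ , f , adj⇔) even = ≤radius G λ u →
  let (b , far) = opposite even (from u)
      v         = to b
  in ℕₚ.≤-trans (subst (_≤ dist G u v) (trans (cong (cyc (suc n) (toℕ (from u)) ∘ toℕ) (strictlyInverseʳ b)) far)
       (φ≤dist G (φ u) (φ-step u) v (φ-self u)
         (ℕₚ.≤-trans (ℕₚ.m⊓n≤n _ _) (ℕₚ.m∸n≤m (suc n) ∣ toℕ (from u) - toℕ (from v) ∣))))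
       (dist≤ecc G u v)
  where
  open Inverse f using (to; from; strictlyInverseˡ; strictlyInverseʳ)
  φ : Fin (suc n) → Fin (suc n) → ℕ
  φ u x = cyc (suc n) (toℕ (from u)) (toℕ (from x))
  φ-step : ∀ u {x y} → Adj G x y → φ u y ≤ suc (φ u x)
  φ-step u {x} {y} e = cyc-step (from u) (from x) (from y) (Equivalence.to (adj⇔ (from x) (from y))
    (≡.subst₂ (Adj G) (≡.sym (strictlyInverseˡ x)) (≡.sym (strictlyInverseˡ y)) e))
  φ-self : ∀ u → φ u u ≡ 0
  φ-self u = cong (λ d → d ℕ.⊓ (suc n ∸ d)) (ℕₚ.∣n-n∣≡0 (toℕ (from u)))

cycleGraph-cycle : ∀ {n} (G : Graph (suc (suc (suc n)))) → IsCycleGraph G → ∃ λ (C : Cycle G) → ∀ v → ∃ λ i → vtx C i ≡ v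
cycleGraph-cycle {n} G (_ , f , adj⇔) = C , λ v → from v , strictlyInverseˡ v
  where
  open Inverse f using (to; from; strictlyInverseˡ; strictlyInverseʳ)
  C : Cycle G
  C = record
    { m     = n
    ; vtx   = to
    ; inj   = λ {x} {y} e → trans (≡.sym (strictlyInverseʳ x)) (trans (cong from e) (strictlyInverseʳ y))
    ; cons  = λ i → Equivalence.from (adj⇔ _ _) (inj₁ (cong suc (Finₚ.toℕ-inject₁ i)))
    ; close = Equivalence.from (adj⇔ _ _) (inj₂ (inj₂ (inj₁ (cong suc (Finₚ.toℕ-fromℕ _) , refl))))
    }

-- The cycle is read off from the isomorphism, so every vertex lies on it and `harmonic≤` applies.
-- Its value K/2 is t, which is at most the radius.
cycleGraph-harmonic≤ : ∀ {n} (G : Graph (suc n)) → Connected G →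
  (∀ (C C′ : Cycle G) u v → CycleEdge C u v ⇔ CycleEdge C′ u v) →
  IsCycleGraph G → 2 ∣ suc n → harmonic G ℚ.≤ ι (radius G)
-- Matching on the proof of 3 ≤ n + 1 brings the vertex count into the form required by
-- `cycleGraph-cycle`.
cycleGraph-harmonic≤ G conn uniq cg@(s≤s (s≤s (s≤s z≤n)) , _) (divides t eq) = begin
  harmonic G                     ≤⟨ harmonic≤ flat ⟩
  twentieths (+ (10 * K))        ≤⟨ twentieths-mono-≤ (ℤ.+≤+ 10K≤20r) ⟩
  twentieths (+ (20 * radius G)) ≡⟨ twentieths-ι (radius G) ⟩
  ι (radius G)                   ∎
  where
  open ℚₚ.≤-Reasoning
  C = proj₁ (cycleGraph-cycle G cg)
  open CycleCase G conn uniq C using (K; δ; γ; δ-γ; harmonic≤)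
  flat : ∀ v → δ v ≡ 0
  flat v with proj₂ (cycleGraph-cycle G cg) v
  ... | i , refl = δ-γ i
  even : K ≡ t + t
  even = trans eq (double t)
    where
    double : ∀ t → t * 2 ≡ t + t
    double = ℕSolver.solve-∀
  10K≤20r : 10 * K ≤ 20 * radius G
  10K≤20r = ℕₚ.≤-trans (ℕₚ.≤-reflexive (trans (cong (10 *_) even) (twenty t)))
    (ℕₚ.*-monoʳ-≤ 20 (cycleGraph-radius {t = t} G cg even))
    where
    twenty : ∀ t → 10 * (t + t) ≡ 20 * t
    twenty = ℕSolver.solve-∀

theorem2 : ∀ (n : ℕ) (G : Graph (suc n)) → Connected G → Unicyclic G →
    ((+ radius G) / 1 ℚ.≤ harmonic G)
    × ((harmonic G ≡ (+ radius G) / 1) ⇔ (IsCycleGraph G × 2 ∣ suc n))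
theorem2 n G conn (C , uniq) = bound ,
  mk⇔ (λ eq → equality⇒ (trans eq (cong ι (≡.sym R≡radius))))
      (λ (cg , even) → ℚₚ.≤-antisym (cycleGraph-harmonic≤ G conn uniq cg even) bound)
  where
  open CycleCase G conn uniq C using (R≡radius; lower-bound; equality⇒)
  bound : ι (radius G) ℚ.≤ harmonic G
  bound = subst (λ r → ι r ℚ.≤ harmonic G) R≡radius lower-bound
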